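{- Let $q\ge0$ be a fixed integer. The number of Motzkin trees of size $n$ with exactly $q$ unary nodes is $0$ if $n\equiv q \pmod 2$; otherwise it is asymptotically equivalent to $$\sqrt{\frac{2}{\pi}}\;\frac{1}{2^q\,q!}\;2^n\,n^{q-\frac32},$$ as $n\to\infty$ (with $n\not\equiv q \pmod 2$).
   Context: A Motzkin tree is a finite plane rooted tree in which every node has 0, 1 or 2 children; nodes with exactly one child are called unary nodes. The size is the total number of nodes. -}

module Defs where

open import Data.Empty using (⊥-elim)
open import Data.Fin.Base using (Fin; zero; suc)
open import Data.List.Base using (List; []; _∷_; _++_; map; filter; deduplicate; cartesianProductWith; length; lookup)
open import Data.List.Membership.Propositional using (_∈_)
open import Data.List.Membership.Propositional.Properties
  using (∈-map⁺; ∈-++⁺ˡ; ∈-++⁺ʳ; ∈-filter⁺; ∈-filter⁻; ∈-deduplicate⁺; ∈-deduplicate⁻; ∈-lookup; ∈-cartesianProductWith⁺)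
open import Data.List.Relation.Unary.Any using (here; there; index)
open import Data.List.Relation.Unary.Any.Properties using (lookup-index)
open import Data.List.Relation.Unary.All as All using ()
open import Data.List.Relation.Unary.AllPairs using (_∷_)
open import Data.List.Relation.Unary.Unique.Propositional using (Unique)
open import Data.List.Relation.Unary.Unique.DecPropositional.Properties using (deduplicate-!)
open import Data.Nat.Base as ℕ using (ℕ; zero; suc; z≤n; s≤s)
import Data.Nat.Properties as ℕ
import Data.Nat.DivMod as ℕ
open import Data.Integer.Base as ℤ using (ℤ; +_; +[1+_]; -[1+_])
import Data.Integer.DivMod as ℤ
import Data.Integer.Properties as ℤ
open import Data.Product.Base using (Σ; Σ-syntax; ∃; ∃-syntax; _×_; _,_; proj₁; proj₂)
open import Data.Rational.Base
open import Data.Rational.Literals using (fromℤ)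
open import Data.Rational.Properties
open import Data.Rational.Solver using (module +-*-Solver)
import Data.Rational.Unnormalised.Base as ℚᵘ
import Data.Rational.Unnormalised.Properties as ℚᵘ
open import Data.Sum.Base using (inj₁; inj₂)
open import Function.Base using (case_of_)
open import Function.Bundles using (_↔_; mk↔ₛ′)
open import Relation.Binary.Definitions using (DecidableEquality)
open import Relation.Binary.PropositionalEquality
open import Relation.Nullary.Decidable using (Dec; yes; no; _×-dec_)

data Motzkin : Set where
  leaf   : Motzkin
  unary  : Motzkin → Motzkin
  binary : Motzkin → Motzkin → Motzkin

size : Motzkin → ℕ
size leaf         = 1
size (unary t)    = suc (size t)
size (binary l r) = suc (size l ℕ.+ size r)

unaries : Motzkin → ℕ
unaries leaf         = 0
unaries (unary t)    = suc (unaries t)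
unaries (binary l r) = unaries l ℕ.+ unaries r

MotzkinOf : ℕ → ℕ → Set
MotzkinOf n q = Σ[ t ∈ Motzkin ] size t ≡ n × unaries t ≡ q

_≟ᴹ_ : DecidableEquality Motzkin
leaf       ≟ᴹ leaf         = yes refl
leaf       ≟ᴹ unary _      = no λ ()
leaf       ≟ᴹ binary _ _   = no λ ()
unary _    ≟ᴹ leaf         = no λ ()
unary t    ≟ᴹ unary u with t ≟ᴹ u
... | yes refl = yes refl
... | no  t≢u  = no λ { refl → t≢u refl }
unary _    ≟ᴹ binary _ _   = no λ ()
binary _ _ ≟ᴹ leaf         = no λ ()
binary _ _ ≟ᴹ unary _      = no λ ()
binary l r ≟ᴹ binary l′ r′ with l ≟ᴹ l′ | r ≟ᴹ r′
... | yes refl | yes refl = yes refl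
... | no  l≢l′ | _        = no λ { refl → l≢l′ refl }
... | yes _    | no  r≢r′ = no λ { refl → r≢r′ refl }

ofHeight≤ : ℕ → List Motzkin
ofHeight≤ zero    = []
ofHeight≤ (suc h) =
  leaf ∷ map unary (ofHeight≤ h) ++ cartesianProductWith binary (ofHeight≤ h) (ofHeight≤ h)

∈-ofHeight≤ : ∀ {h} t → size t ℕ.≤ h → t ∈ ofHeight≤ h
∈-ofHeight≤ leaf      (s≤s _)   = here refl
∈-ofHeight≤ (unary t) (s≤s t≤h) = there (∈-++⁺ˡ (∈-map⁺ unary (∈-ofHeight≤ t t≤h)))
∈-ofHeight≤ {suc h} (binary l r) (s≤s lr≤h) = there (∈-++⁺ʳ (map unary (ofHeight≤ h))
  (∈-cartesianProductWith⁺ binary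
    (∈-ofHeight≤ l (ℕ.≤-trans (ℕ.m≤m+n (size l) (size r)) lr≤h))
    (∈-ofHeight≤ r (ℕ.≤-trans (ℕ.m≤n+m (size r) (size l)) lr≤h))))

lookup-injective : ∀ {A : Set} {xs : List A} → Unique xs → ∀ i j → lookup xs i ≡ lookup xs j → i ≡ j
lookup-injective (_ ∷ _)     zero    zero    _  = refl
lookup-injective (x∉xs ∷ _)  zero    (suc j) eq = ⊥-elim (All.lookup x∉xs (∈-lookup j) eq)
lookup-injective (x∉xs ∷ _)  (suc i) zero    eq = ⊥-elim (All.lookup x∉xs (∈-lookup i) (sym eq))
lookup-injective (_ ∷ xs!)   (suc i) (suc j) eq = cong suc (lookup-injective xs! i j eq)

module _ (n q : ℕ) where

  private
    P : Motzkin → Set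
    P t = size t ≡ n × unaries t ≡ q

    P? : ∀ t → Dec (P t)
    P? t = (size t ℕ.≟ n) ×-dec (unaries t ℕ.≟ q)

    P-irrelevant : ∀ {t} (p p′ : P t) → p ≡ p′
    P-irrelevant (a , b) (a′ , b′) = cong₂ _,_ (ℕ.≡-irrelevant a a′) (ℕ.≡-irrelevant b b′)

    trees : List Motzkin
    trees = deduplicate _≟ᴹ_ (filter P? (ofHeight≤ n))

    complete : ∀ {t} → P t → t ∈ trees
    complete {t} p@(s≡n , _) =
      ∈-deduplicate⁺ _≟ᴹ_ (∈-filter⁺ P? (∈-ofHeight≤ t (ℕ.≤-reflexive s≡n)) p)

    sound : ∀ {t} → t ∈ trees → P t
    sound t∈ = proj₂ (∈-filter⁻ P? {xs = ofHeight≤ n} (∈-deduplicate⁻ _≟ᴹ_ _ t∈))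

    pair-≡ : ∀ {t u} {p : P t} {p′ : P u} → t ≡ u → _≡_ {A = MotzkinOf n q} (t , p) (u , p′)
    pair-≡ {t} refl = cong (t ,_) (P-irrelevant _ _)

  MotzkinOf-finite : ∃[ c ] (MotzkinOf n q ↔ Fin c)
  MotzkinOf-finite = length trees , mk↔ₛ′
    (λ (t , p) → index (complete p))
    (λ i → lookup trees i , sound (∈-lookup i))
    (λ i → lookup-injective (deduplicate-! _≟ᴹ_ (filter P? (ofHeight≤ n))) _ _ (sym (lookup-index (complete (sound (∈-lookup i))))))
    (λ (t , p) → pair-≡ (sym (lookup-index (complete p))))

  motzkinCount : ℕ
  motzkinCount = proj₁ MotzkinOf-finite

fromℕ : ℕ → ℚ
fromℕ n = fromℤ (+ n)

infix 30 _⁻¹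
infixr 8 _^_ _^ℤ_

-- Total, with the junk value 0 ⁻¹ = 0.
_⁻¹ : ℚ → ℚ
mkℚ (+ 0) _ _        ⁻¹ = 0ℚ
p@(mkℚ +[1+ _ ] _ _) ⁻¹ = 1/ p
p@(mkℚ -[1+ _ ] _ _) ⁻¹ = 1/ p

_^_ : ℚ → ℕ → ℚ
p ^ zero  = 1ℚ
p ^ suc n = p * p ^ n

_^ℤ_ : ℚ → ℤ → ℚ
p ^ℤ (+ n)      = p ^ n
p ^ℤ (-[1+ n ]) = (p ^ suc n) ⁻¹

⁻¹-inverseʳ : ∀ {p} → 0ℚ < p → p * p ⁻¹ ≡ 1ℚ
⁻¹-inverseʳ {mkℚ (+ 0) _ _}        (*<* (ℤ.+<+ ()))
⁻¹-inverseʳ {p@(mkℚ +[1+ _ ] _ _)} _ = *-inverseʳ p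
⁻¹-inverseʳ { (mkℚ -[1+ _ ] _ _)}  (*<* ())

⁻¹-pos : ∀ {p} → 0ℚ < p → 0ℚ < p ⁻¹
⁻¹-pos {mkℚ (+ 0) _ _}        (*<* (ℤ.+<+ ()))
⁻¹-pos {p@(mkℚ +[1+ _ ] _ _)} _ = positive⁻¹ (1/ p) {{1/pos⇒pos p}}
⁻¹-pos { (mkℚ -[1+ _ ] _ _)}  (*<* ())

*-pos : ∀ {p q} → 0ℚ < p → 0ℚ < q → 0ℚ < p * q
*-pos {p} {q} 0<p 0<q = subst (_< p * q) (*-zeroʳ p) (*-monoʳ-<-pos p {{positive 0<p}} 0<q)

*-monoʳ-≤ : ∀ {p q r} → 0ℚ ≤ r → p ≤ q → r * p ≤ r * q
*-monoʳ-≤ {r = r} 0≤r = *-monoˡ-≤-nonNeg r {{nonNegative 0≤r}}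

*-monoˡ-≤ : ∀ {p q r} → 0ℚ ≤ r → p ≤ q → p * r ≤ q * r
*-monoˡ-≤ {r = r} 0≤r = *-monoʳ-≤-nonNeg r {{nonNegative 0≤r}}

*-mono-≤ : ∀ {p q r s} → 0ℚ ≤ p → 0ℚ ≤ s → p ≤ q → r ≤ s → p * r ≤ q * s
*-mono-≤ 0≤p 0≤s p≤q r≤s = ≤-trans (*-monoʳ-≤ 0≤p r≤s) (*-monoˡ-≤ 0≤s p≤q)

0<½ : 0ℚ < ½
0<½ = positive⁻¹ ½

0<1 : 0ℚ < 1ℚ
0<1 = positive⁻¹ 1ℚ

half+half : ∀ p → ½ * p + ½ * p ≡ p
half+half p = trans (sym (*-distribʳ-+ p ½ ½)) (*-identityˡ p)

∣∣-< : ∀ {p r} → p < r → - p < r → ∣ p ∣ < r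
∣∣-< {p} p<r -p<r with ∣p∣≡p∨∣p∣≡-p p
... | inj₁ eq = subst (_< _) (sym eq) p<r
... | inj₂ eq = subst (_< _) (sym eq) -p<r

∣∣-≤ : ∀ {p r} → p ≤ r → - p ≤ r → ∣ p ∣ ≤ r
∣∣-≤ {p} p≤r -p≤r with ∣p∣≡p∨∣p∣≡-p p
... | inj₁ eq = subst (_≤ _) (sym eq) p≤r
... | inj₂ eq = subst (_≤ _) (sym eq) -p≤r

p≤∣p∣ : ∀ p → p ≤ ∣ p ∣
p≤∣p∣ p with ≤-total 0ℚ p
... | inj₁ 0≤p = ≤-reflexive (sym (0≤p⇒∣p∣≡p 0≤p))
... | inj₂ p≤0 = ≤-trans p≤0 (0≤∣p∣ p)

neg-sub : ∀ p q → - (p - q) ≡ q - p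
neg-sub = solve 2 (λ p q → :- (p :- q) := q :- p) refl where open +-*-Solver

swap-∣-∣ : ∀ p q → ∣ p - q ∣ ≡ ∣ q - p ∣
swap-∣-∣ p q = trans (cong ∣_∣ (sym (neg-sub q p))) (∣-p∣≡∣p∣ (q - p))

≤-from-sub : ∀ {p q r} → p - q ≤ r → p ≤ q + r
≤-from-sub {p} {q} {r} h = subst (_≤ q + r)
  (solve 2 (λ p q → q :+ (p :- q) := p) refl p q) (+-monoʳ-≤ q h)
  where open +-*-Solver

<-from-sub : ∀ {p q r} → p - q < r → p < q + r
<-from-sub {p} {q} {r} h = subst (_< q + r)
  (solve 2 (λ p q → q :+ (p :- q) := p) refl p q) (+-monoʳ-< q h)
  where open +-*-Solver

<-to-sub : ∀ {p q r} → p < q + r → p - q < r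
<-to-sub {p} {q} {r} h = subst (p - q <_)
  (solve 2 (λ q r → (q :+ r) :- q := r) refl q r) (+-monoˡ-< (- q) h)
  where open +-*-Solver

∣∣∣∣-lipschitz : ∀ p q → ∣ ∣ p ∣ - ∣ q ∣ ∣ ≤ ∣ p - q ∣
∣∣∣∣-lipschitz p q = ∣∣-≤ (one p q)
  (subst₂ _≤_ (sym (neg-sub ∣ p ∣ ∣ q ∣)) (swap-∣-∣ q p) (one q p))
  where
  open +-*-Solver
  one : ∀ p q → ∣ p ∣ - ∣ q ∣ ≤ ∣ p - q ∣
  one p q = subst (∣ p ∣ - ∣ q ∣ ≤_)
    (solve 2 (λ a b → (a :+ b) :- b := a) refl ∣ p - q ∣ ∣ q ∣)
    (+-monoˡ-≤ (- ∣ q ∣) (subst (λ r → ∣ r ∣ ≤ ∣ p - q ∣ + ∣ q ∣)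
      (solve 2 (λ p q → (p :- q) :+ q := p) refl p q) (∣p+q∣≤∣p∣+∣q∣ (p - q) q)))

fromℚᵘ-mono-≤ : ∀ {p q} → p ℚᵘ.≤ q → fromℚᵘ p ≤ fromℚᵘ q
fromℚᵘ-mono-≤ {p} {q} p≤q = toℚᵘ-cancel-≤
  (ℚᵘ.≤-respˡ-≃ (ℚᵘ.≃-sym (toℚᵘ-fromℚᵘ p)) (ℚᵘ.≤-respʳ-≃ (ℚᵘ.≃-sym (toℚᵘ-fromℚᵘ q)) p≤q))

fromℚᵘ-mono-< : ∀ {p q} → p ℚᵘ.< q → fromℚᵘ p < fromℚᵘ q
fromℚᵘ-mono-< {p} {q} p<q = toℚᵘ-cancel-<
  (ℚᵘ.<-respˡ-≃ (ℚᵘ.≃-sym (toℚᵘ-fromℚᵘ p)) (ℚᵘ.<-respʳ-≃ (ℚᵘ.≃-sym (toℚᵘ-fromℚᵘ q)) p<q))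

/-antimono-≤ : ∀ a {m n} → m ℕ.≤ n → + a / suc n ≤ + a / suc m
/-antimono-≤ a {m} {n} m≤n = fromℚᵘ-mono-≤ {ℚᵘ.mkℚᵘ (+ a) n} {ℚᵘ.mkℚᵘ (+ a) m}
  (ℚᵘ.*≤* (subst₂ ℤ._≤_ (ℤ.pos-* a (suc m)) (ℤ.pos-* a (suc n))
    (ℤ.+≤+ (ℕ.*-monoʳ-≤ a (s≤s m≤n)))))

archimedean : ∀ a {ε} → 0ℚ < ε → ∃[ N ] (∀ {k} → N ℕ.≤ k → + a / suc k < ε)
archimedean a {mkℚ (+ 0) _ _} (*<* (ℤ.+<+ ()))
archimedean a {mkℚ -[1+ _ ] _ _} (*<* ())
archimedean a {ε@(mkℚ +[1+ n ] d _)} _ = a ℕ.* suc d , λ {k} N≤k →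
  subst (_ <_) (fromℚᵘ-toℚᵘ ε) (fromℚᵘ-mono-< {ℚᵘ.mkℚᵘ (+ a) k} {toℚᵘ ε}
    (ℚᵘ.*<* (subst₂ ℤ._<_ (ℤ.pos-* a (suc d)) (ℤ.pos-* (suc n) (suc k))
      (ℤ.+<+ (ℕ.<-≤-trans (s≤s N≤k) (ℕ.m≤m+n (suc k) (n ℕ.* suc k)))))))

IsCauchy : (ℕ → ℚ) → Set
IsCauchy x = ∀ ε → 0ℚ < ε → ∃[ N ] (∀ m n → N ℕ.≤ m → N ℕ.≤ n → ∣ x m - x n ∣ < ε)

-- Equality of reals is not propositional equality of sequences;
-- comparisons are made with _≤ᴿ_ and _<ᴿ_ below.
record ℝ : Set where
  constructor mkℝ
  field
    seq    : ℕ → ℚ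
    cauchy : IsCauchy seq

open ℝ public

infix  4 _≤ᴿ_ _<ᴿ_
infixl 6 _-ᴿ_
infixl 7 _*ᴿ_

_≤ᴿ_ : ℝ → ℝ → Set
x ≤ᴿ y = ∀ ε → 0ℚ < ε → ∃[ N ] (∀ n → N ℕ.≤ n → seq x n ≤ seq y n + ε)

_<ᴿ_ : ℝ → ℝ → Set
x <ᴿ y = ∃[ ε ] (0ℚ < ε × ∃[ N ] (∀ n → N ℕ.≤ n → seq x n + ε ≤ seq y n))

ι : ℚ → ℝ
ι p = mkℝ (λ _ → p) λ ε 0<ε → 0 , λ _ _ _ _ → subst (_< ε) (sym (cong ∣_∣ (+-inverseʳ p))) 0<ε

0ᴿ : ℝ
0ᴿ = ι 0ℚ

_-ᴿ_ : ℝ → ℝ → ℝ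
x -ᴿ y = mkℝ (λ n → seq x n - seq y n) λ ε 0<ε →
  let 0<ε/2 = *-pos 0<½ 0<ε
      M , x-close = cauchy x (½ * ε) 0<ε/2
      N , y-close = cauchy y (½ * ε) 0<ε/2
  in M ℕ.⊔ N , λ m n m≥ n≥ → begin-strict
    ∣ (seq x m - seq y m) - (seq x n - seq y n) ∣
      ≡⟨ cong ∣_∣ (solve 4 (λ a b c d → (a :- b) :- (c :- d) := (a :- c) :- (b :- d)) refl
           (seq x m) (seq y m) (seq x n) (seq y n)) ⟩
    ∣ (seq x m - seq x n) - (seq y m - seq y n) ∣
      ≤⟨ ∣p-q∣≤∣p∣+∣q∣ (seq x m - seq x n) (seq y m - seq y n) ⟩
    ∣ seq x m - seq x n ∣ + ∣ seq y m - seq y n ∣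
      <⟨ +-mono-< (x-close m n (ℕ.m⊔n≤o⇒m≤o M N m≥) (ℕ.m⊔n≤o⇒m≤o M N n≥))
                  (y-close m n (ℕ.m⊔n≤o⇒n≤o M N m≥) (ℕ.m⊔n≤o⇒n≤o M N n≥)) ⟩
    ½ * ε + ½ * ε ≡⟨ half+half ε ⟩
    ε ∎
  where
  open ≤-Reasoning
  open +-*-Solver

∣_∣ᴿ : ℝ → ℝ
∣ x ∣ᴿ = mkℝ (λ n → ∣ seq x n ∣) λ ε 0<ε →
  let N , close = cauchy x ε 0<ε
  in N , λ m n m≥ n≥ → ≤-<-trans (∣∣∣∣-lipschitz (seq x m) (seq x n)) (close m n m≥ n≥)

bounded : ∀ x → ∃[ B ] (0ℚ < B × ∃[ N ] (∀ n → N ℕ.≤ n → ∣ seq x n ∣ ≤ B))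
bounded x with cauchy x 1ℚ 0<1
... | N , close = ∣ seq x N ∣ + 1ℚ
  , +-mono-≤-< (0≤∣p∣ (seq x N)) 0<1
  , N , λ n n≥ → ≤-from-sub {∣ seq x n ∣} {∣ seq x N ∣} (begin
      ∣ seq x n ∣ - ∣ seq x N ∣     ≤⟨ p≤∣p∣ (∣ seq x n ∣ - ∣ seq x N ∣) ⟩
      ∣ ∣ seq x n ∣ - ∣ seq x N ∣ ∣ ≤⟨ ∣∣∣∣-lipschitz (seq x n) (seq x N) ⟩
      ∣ seq x n - seq x N ∣         <⟨ close n N n≥ ℕ.≤-refl ⟩
      1ℚ                            ∎)
  where open ≤-Reasoning

_*ᴿ_ : ℝ → ℝ → ℝ
x *ᴿ y = mkℝ (λ n → seq x n * seq y n) λ ε 0<ε →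
  let A , 0<A , K , x≤A = bounded x
      B , 0<B , L , y≤B = bounded y
      C     = A + B
      0<C   = +-mono-< 0<A 0<B
      A≤C   = subst (_≤ C) (+-identityʳ A) (+-monoʳ-≤ A (<⇒≤ 0<B))
      B≤C   = subst (_≤ C) (+-identityˡ B) (+-monoˡ-≤ B (<⇒≤ 0<A))
      δ     = ½ * ε * C ⁻¹
      0<δ   = *-pos (*-pos 0<½ 0<ε) (⁻¹-pos 0<C)
      M , x-close = cauchy x δ 0<δ
      N , y-close = cauchy y δ 0<δ
      Cδ≡ε/2 : C * δ ≡ ½ * ε
      Cδ≡ε/2 = trans (solve 3 (λ c e i → c :* (e :* i) := e :* (c :* i)) refl C (½ * ε) (C ⁻¹))
                     (trans (cong (½ * ε *_) (⁻¹-inverseʳ 0<C)) (*-identityʳ (½ * ε)))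
  in (K ℕ.⊔ L) ℕ.⊔ (M ℕ.⊔ N) , λ m n m≥ n≥ →
    let xm = seq x m ; xn = seq x n ; ym = seq y m ; yn = seq y n
        KL≤m = ℕ.m⊔n≤o⇒m≤o (K ℕ.⊔ L) (M ℕ.⊔ N) m≥
        KL≤n = ℕ.m⊔n≤o⇒m≤o (K ℕ.⊔ L) (M ℕ.⊔ N) n≥
        MN≤m = ℕ.m⊔n≤o⇒n≤o (K ℕ.⊔ L) (M ℕ.⊔ N) m≥
        MN≤n = ℕ.m⊔n≤o⇒n≤o (K ℕ.⊔ L) (M ℕ.⊔ N) n≥
        dx<δ = x-close m n (ℕ.m⊔n≤o⇒m≤o M N MN≤m) (ℕ.m⊔n≤o⇒m≤o M N MN≤n)
        dy<δ = y-close m n (ℕ.m⊔n≤o⇒n≤o M N MN≤m) (ℕ.m⊔n≤o⇒n≤o M N MN≤n)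
    in begin-strict
    ∣ xm * ym - xn * yn ∣
      ≡⟨ cong ∣_∣ (solve 4 (λ a b c d → a :* b :- c :* d := a :* (b :- d) :+ d :* (a :- c)) refl
           xm ym xn yn) ⟩
    ∣ xm * (ym - yn) + yn * (xm - xn) ∣
      ≤⟨ ∣p+q∣≤∣p∣+∣q∣ (xm * (ym - yn)) (yn * (xm - xn)) ⟩
    ∣ xm * (ym - yn) ∣ + ∣ yn * (xm - xn) ∣
      ≡⟨ cong₂ _+_ (∣p*q∣≡∣p∣*∣q∣ xm (ym - yn)) (∣p*q∣≡∣p∣*∣q∣ yn (xm - xn)) ⟩
    ∣ xm ∣ * ∣ ym - yn ∣ + ∣ yn ∣ * ∣ xm - xn ∣
      ≤⟨ +-mono-≤
           (*-monoˡ-≤ (0≤∣p∣ (ym - yn)) (≤-trans (x≤A m (ℕ.m⊔n≤o⇒m≤o K L KL≤m)) A≤C))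
           (*-monoˡ-≤ (0≤∣p∣ (xm - xn)) (≤-trans (y≤B n (ℕ.m⊔n≤o⇒n≤o K L KL≤n)) B≤C)) ⟩
    C * ∣ ym - yn ∣ + C * ∣ xm - xn ∣
      <⟨ +-mono-< (*-monoʳ-<-pos C {{positive 0<C}} dy<δ) (*-monoʳ-<-pos C {{positive 0<C}} dx<δ) ⟩
    C * δ + C * δ     ≡⟨ cong₂ _+_ Cδ≡ε/2 Cδ≡ε/2 ⟩
    ½ * ε + ½ * ε ≡⟨ half+half ε ⟩
    ε ∎
  where
  open ≤-Reasoning
  open +-*-Solver

recip : (x : ℝ) → 0ᴿ <ᴿ x → ℝ
recip x (δ , 0<δ , M , δ≤x) = mkℝ (λ n → seq x n ⁻¹) λ ε 0<ε →
  let N , close = cauchy x (ε * (δ * δ)) (*-pos 0<ε (*-pos 0<δ 0<δ))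
  in M ℕ.⊔ N , λ m n m≥ n≥ →
    let a = seq x m ; b = seq x n
        δ≤a = subst (_≤ a) (+-identityˡ δ) (δ≤x m (ℕ.m⊔n≤o⇒m≤o M N m≥))
        δ≤b = subst (_≤ b) (+-identityˡ δ) (δ≤x n (ℕ.m⊔n≤o⇒m≤o M N n≥))
        0<a = <-≤-trans 0<δ δ≤a
        0<b = <-≤-trans 0<δ δ≤b
        0≤ab = <⇒≤ (*-pos 0<a 0<b)
        cleared : (a ⁻¹ - b ⁻¹) * (a * b) ≡ b - a
        cleared = trans
          (solve 4 (λ a b i j → (i :- j) :* (a :* b) := (a :* i) :* b :- (b :* j) :* a) refl a b (a ⁻¹) (b ⁻¹))
          (cong₂ _-_ (trans (cong (_* b) (⁻¹-inverseʳ 0<a)) (*-identityˡ b))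
                     (trans (cong (_* a) (⁻¹-inverseʳ 0<b)) (*-identityˡ a)))
    in *-cancelʳ-<-nonNeg (a * b) {{nonNegative 0≤ab}} (begin-strict
    ∣ a ⁻¹ - b ⁻¹ ∣ * (a * b)       ≡⟨ cong (∣ a ⁻¹ - b ⁻¹ ∣ *_) (sym (0≤p⇒∣p∣≡p 0≤ab)) ⟩
    ∣ a ⁻¹ - b ⁻¹ ∣ * ∣ a * b ∣     ≡⟨ sym (∣p*q∣≡∣p∣*∣q∣ (a ⁻¹ - b ⁻¹) (a * b)) ⟩
    ∣ (a ⁻¹ - b ⁻¹) * (a * b) ∣     ≡⟨ cong ∣_∣ cleared ⟩
    ∣ b - a ∣                       <⟨ close n m (ℕ.m⊔n≤o⇒n≤o M N n≥) (ℕ.m⊔n≤o⇒n≤o M N m≥) ⟩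
    ε * (δ * δ)                     ≤⟨ *-monoʳ-≤ (<⇒≤ 0<ε) (*-mono-≤ (<⇒≤ 0<δ) (<⇒≤ 0<b) δ≤a δ≤b) ⟩
    ε * (a * b)                     ∎)
  where
  open ≤-Reasoning
  open +-*-Solver

isqrt : ℕ → ℕ
isqrt zero    = 0
isqrt (suc n) with suc (isqrt n) ℕ.* suc (isqrt n) ℕ.≤? suc n
... | yes _ = suc (isqrt n)
... | no  _ = isqrt n

-- ⌊√(max(p,0)·(k+1)²)⌋ / (k+1)
sqrtApprox : ℕ → ℚ → ℚ
sqrtApprox k p = + isqrt ℤ.∣ floor ((p ⊔ 0ℚ) * (fromℕ (suc k) * fromℕ (suc k))) ∣ / suc k

isqrt-lower : ∀ n → isqrt n ℕ.* isqrt n ℕ.≤ n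
isqrt-lower zero = z≤n
isqrt-lower (suc n) with suc (isqrt n) ℕ.* suc (isqrt n) ℕ.≤? suc n
... | yes h = h
... | no  _ = ℕ.m≤n⇒m≤1+n (isqrt-lower n)

isqrt-upper : ∀ n → n ℕ.< suc (isqrt n) ℕ.* suc (isqrt n)
isqrt-upper zero = s≤s z≤n
isqrt-upper (suc n) with suc (isqrt n) ℕ.* suc (isqrt n) ℕ.≤? suc n
... | yes _ = ℕ.<-≤-trans (s≤s (isqrt-upper n))
                (ℕ.*-mono-< (ℕ.n<1+n (suc (isqrt n))) (ℕ.n<1+n (suc (isqrt n))))
... | no ¬h = ℕ.≰⇒> ¬h

fromℕ-* : ∀ m n → fromℕ (m ℕ.* n) ≡ fromℕ m * fromℕ n
fromℕ-* m n = toℚᵘ-injective (ℚᵘ.≃-trans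
  (ℚᵘ.≃-reflexive (cong (λ i → ℚᵘ.mkℚᵘ i 0) (ℤ.pos-* m n)))
  (ℚᵘ.≃-sym (toℚᵘ-homo-* (fromℕ m) (fromℕ n))))

fromℕ-suc : ∀ n → fromℕ (suc n) ≡ fromℕ n + 1ℚ
fromℕ-suc n = toℚᵘ-injective (ℚᵘ.≃-trans
  (ℚᵘ.≃-reflexive (cong (λ i → ℚᵘ.mkℚᵘ i 0)
    (trans (cong +_ (sym (trans (cong (ℕ._+ 1) (ℕ.*-identityʳ n)) (ℕ.+-comm n 1))))
           (cong (ℤ._+ + 1) (ℤ.pos-* n 1)))))
  (ℚᵘ.≃-sym (toℚᵘ-homo-+ (fromℕ n) 1ℚ)))

fromℕ-mono-≤ : ∀ {m n} → m ℕ.≤ n → fromℕ m ≤ fromℕ n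
fromℕ-mono-≤ m≤n = *≤* (ℤ.*-monoʳ-≤-nonNeg (+ 1) (ℤ.+≤+ m≤n))

/-*-cancel : ∀ j k → (+ j / suc k) * fromℕ (suc k) ≡ fromℕ j
/-*-cancel j k = toℚᵘ-injective (ℚᵘ.≃-trans (toℚᵘ-homo-* (+ j / suc k) (fromℕ (suc k)))
  (ℚᵘ.≃-trans (ℚᵘ.*-congʳ (toℚᵘ-fromℚᵘ (ℚᵘ.mkℚᵘ (+ j) k)))
    (ℚᵘ.*≡* (trans (ℤ.*-identityʳ _) (cong (λ d → + j ℤ.* + d) (sym (ℕ.*-identityʳ (suc k))))))))

floor-≡ : ∀ a d → ℤ.∣ + a ℤ./ + suc d ∣ ≡ a ℕ./ suc d
floor-≡ a d = cong ℤ.∣_∣ (ℤ.div-pos-is-/ℕ (+ a) (suc d))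

floor-lower : ∀ {p} → 0ℚ ≤ p → fromℕ ℤ.∣ floor p ∣ ≤ p
floor-lower {mkℚ -[1+ _ ] _ _} (*≤* ())
floor-lower {mkℚ (+ a) d _} _ = *≤* (subst₂ ℤ._≤_
  (trans (ℤ.pos-* (a ℕ./ suc d) (suc d)) (cong (λ f → + f ℤ.* + suc d) (sym (floor-≡ a d))))
  (sym (ℤ.*-identityʳ (+ a)))
  (ℤ.+≤+ (ℕ.m/n*n≤m a (suc d))))

floor-upper : ∀ {p} → 0ℚ ≤ p → p < fromℕ (suc ℤ.∣ floor p ∣)
floor-upper {mkℚ -[1+ _ ] _ _} (*≤* ())
floor-upper {mkℚ (+ a) d _} _ = *<* (subst₂ ℤ._<_
  (sym (ℤ.*-identityʳ (+ a)))
  (trans (ℤ.pos-* (suc (a ℕ./ suc d)) (suc d)) (cong (λ f → + suc f ℤ.* + suc d) (sym (floor-≡ a d))))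
  (ℤ.+<+ (subst (ℕ._< suc (a ℕ./ suc d) ℕ.* suc d) (sym (ℕ.m≡m%n+[m/n]*n a (suc d)))
    (ℕ.+-monoˡ-< (a ℕ./ suc d ℕ.* suc d) (ℕ.m%n<n a (suc d))))))

0≤-/ : ∀ j k → 0ℚ ≤ + j / suc k
0≤-/ j k = nonNegative⁻¹ (+ j / suc k) {{normalize-nonNeg j (suc k)}}

module SqrtApprox (k : ℕ) (p : ℚ) where
  open ≤-Reasoning
  open +-*-Solver

  K p⁺ r s e : ℚ
  K  = fromℕ (suc k)
  p⁺ = p ⊔ 0ℚ
  r  = p⁺ * (K * K)
  s  = sqrtApprox k p
  e  = + 1 / suc k

  f j : ℕ
  f = ℤ.∣ floor r ∣
  j = isqrt f

  K² : 0ℚ < K * K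
  K² = *-pos (positive⁻¹ K) (positive⁻¹ K)

  0≤r : 0ℚ ≤ r
  0≤r = subst (_≤ r) (*-zeroˡ (K * K)) (*-monoˡ-≤ {r = K * K} (<⇒≤ K²) (p≤q⊔p p 0ℚ))

  sqrtApprox-lower : s * s ≤ p⁺
  sqrtApprox-lower = *-cancelʳ-≤-pos (K * K) {{positive K²}} (begin
    (s * s) * (K * K) ≡⟨ solve 2 (λ s K → (s :* s) :* (K :* K) := (s :* K) :* (s :* K)) refl s K ⟩
    (s * K) * (s * K) ≡⟨ cong₂ _*_ (/-*-cancel j k) (/-*-cancel j k) ⟩
    fromℕ j * fromℕ j ≡⟨ fromℕ-* j j ⟨
    fromℕ (j ℕ.* j)   ≤⟨ fromℕ-mono-≤ (isqrt-lower f) ⟩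
    fromℕ f           ≤⟨ floor-lower {r} 0≤r ⟩
    p⁺ * (K * K)      ∎)

  [s+e]K : fromℕ (suc j) ≡ (s + e) * K
  [s+e]K = trans (fromℕ-suc j) (trans
    (cong₂ _+_ (sym (/-*-cancel j k)) (sym (/-*-cancel 1 k))) (sym (*-distribʳ-+ K s e)))

  sqrtApprox-upper : p⁺ < (s + e) * (s + e)
  sqrtApprox-upper = *-cancelʳ-<-nonNeg (K * K) {{nonNegative (<⇒≤ K²)}} (begin-strict
    p⁺ * (K * K)                   <⟨ floor-upper {r} 0≤r ⟩
    fromℕ (suc f)                  ≤⟨ fromℕ-mono-≤ (isqrt-upper f) ⟩
    fromℕ (suc j ℕ.* suc j)        ≡⟨ fromℕ-* (suc j) (suc j) ⟩
    fromℕ (suc j) * fromℕ (suc j)  ≡⟨ cong₂ _*_ [s+e]K [s+e]K ⟩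
    ((s + e) * K) * ((s + e) * K)
      ≡⟨ solve 2 (λ t K → (t :* K) :* (t :* K) := (t :* t) :* (K :* K)) refl (s + e) K ⟩
    ((s + e) * (s + e)) * (K * K)  ∎)

0≤sqrtApprox : ∀ k p → 0ℚ ≤ sqrtApprox k p
0≤sqrtApprox k p = 0≤-/ (isqrt ℤ.∣ floor ((p ⊔ 0ℚ) * (fromℕ (suc k) * fromℕ (suc k))) ∣) k

open SqrtApprox using (sqrtApprox-lower; sqrtApprox-upper)

sqrtApprox-close : ∀ {k l p q η} → 0ℚ < η → p - q < η * η → + 1 / suc l < η →
  sqrtApprox k p - sqrtApprox l q < η + η
sqrtApprox-close {k} {l} {p} {q} {η} 0<η p-q<η² e<η = ≰⇒> λ far →
  <-irrefl refl (begin-strict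
    s * s                        ≤⟨ sqrtApprox-lower k p ⟩
    p ⊔ 0ℚ                       ≤⟨ ⊔-lub
                                      (≤-trans (<⇒≤ (<-from-sub {p} {q} p-q<η²)) (+-monoˡ-≤ (η * η) (p≤p⊔q q 0ℚ)))
                                      (+-mono-≤ (p≤q⊔p q 0ℚ) (<⇒≤ (*-pos 0<η 0<η))) ⟩
    q⁺ + η * η                   <⟨ +-monoˡ-< (η * η) (sqrtApprox-upper l q) ⟩
    (t + e) * (t + e) + η * η    ≤⟨ +-monoʳ-≤ ((t + e) * (t + e))
                                      (subst (_≤ η * η + ((t + e) * η + (t + e) * η)) (+-identityʳ (η * η))
                                        (+-monoʳ-≤ (η * η) (+-mono-≤ 0≤uη 0≤uη))) ⟩
    (t + e) * (t + e) + (η * η + ((t + e) * η + (t + e) * η))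
      ≡⟨ solve 2 (λ u η → u :* u :+ (η :* η :+ (u :* η :+ u :* η)) := (u :+ η) :* (u :+ η)) refl (t + e) η ⟩
    (t + e + η) * (t + e + η)    ≤⟨ *-mono-≤ (+-mono-≤ 0≤u (<⇒≤ 0<η)) (0≤sqrtApprox k p) (u+η≤s far) (u+η≤s far) ⟩
    s * s                        ∎)
  where
  open ≤-Reasoning
  open +-*-Solver
  s  = sqrtApprox k p
  t  = sqrtApprox l q
  e  = + 1 / suc l
  q⁺ = q ⊔ 0ℚ
  0≤u : 0ℚ ≤ t + e
  0≤u = +-mono-≤ (0≤sqrtApprox l q) (0≤-/ 1 l)
  0≤uη : 0ℚ ≤ (t + e) * η
  0≤uη = subst (_≤ (t + e) * η) (*-zeroˡ η) (*-monoˡ-≤ (<⇒≤ 0<η) 0≤u)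
  u+η≤s : η + η ≤ s - t → t + e + η ≤ s
  u+η≤s far = begin
    t + e + η     ≤⟨ +-monoˡ-≤ η (+-monoʳ-≤ t (<⇒≤ e<η)) ⟩
    t + η + η     ≡⟨ +-assoc t η η ⟩
    t + (η + η)   ≤⟨ +-monoʳ-≤ t far ⟩
    t + (s - t)   ≡⟨ solve 2 (λ s t → t :+ (s :- t) := s) refl s t ⟩
    s             ∎

-- √ x = 0 when x is negative.
√_ : ℝ → ℝ
√ x = mkℝ (λ n → sqrtApprox n (seq x n)) λ ε 0<ε →
  let η   = ½ * ε
      0<η = *-pos 0<½ 0<ε
      M , close = cauchy x (η * η) (*-pos 0<η 0<η)
      N , small = archimedean 1 0<η
      one : ∀ m n → M ℕ.⊔ N ℕ.≤ m → M ℕ.⊔ N ℕ.≤ n →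
            sqrtApprox m (seq x m) - sqrtApprox n (seq x n) < ε
      one m n m≥ n≥ = subst (_ <_) (half+half ε) (sqrtApprox-close {m} {n} {seq x m} {seq x n} 0<η
        (≤-<-trans (p≤∣p∣ (seq x m - seq x n)) (close m n (ℕ.m⊔n≤o⇒m≤o M N m≥) (ℕ.m⊔n≤o⇒m≤o M N n≥)))
        (small (ℕ.m⊔n≤o⇒n≤o M N n≥)))
  in M ℕ.⊔ N , λ m n m≥ n≥ → ∣∣-< (one m n m≥ n≥)
    (subst (_< ε) (sym (neg-sub (sqrtApprox m (seq x m)) (sqrtApprox n (seq x n)))) (one n m n≥ m≥))

leibnizTerm : ℕ → ℚ
leibnizTerm k = (- 1ℚ) ^ k * (+ 4 / suc (2 ℕ.* k))

leibnizSum : ℕ → ℚ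
leibnizSum zero    = 0ℚ
leibnizSum (suc n) = leibnizSum n + leibnizTerm n

absTerm : ℕ → ℚ
absTerm k = + 4 / suc (2 ℕ.* k)

absTerm-antimono : ∀ {m n} → m ℕ.≤ n → absTerm n ≤ absTerm m
absTerm-antimono m≤n = /-antimono-≤ 4 (ℕ.*-monoʳ-≤ 2 m≤n)

altTail : ℕ → ℕ → ℚ
altTail k zero    = 0ℚ
altTail k (suc m) = absTerm k - altTail (suc k) m

leibnizSum-+ : ∀ k m → leibnizSum (m ℕ.+ k) ≡ leibnizSum k + (- 1ℚ) ^ k * altTail k m
leibnizSum-+ k zero = solve 2 (λ s u → s := s :+ u :* con 0ℚ) refl (leibnizSum k) ((- 1ℚ) ^ k)
  where open +-*-Solver
leibnizSum-+ k (suc m) = trans (cong leibnizSum (sym (ℕ.+-suc m k)))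
  (trans (leibnizSum-+ (suc k) m)
    (solve 4 (λ s u b t → (s :+ u :* b) :+ (con (- 1ℚ) :* u) :* t := s :+ u :* (b :- t)) refl
      (leibnizSum k) ((- 1ℚ) ^ k) (absTerm k) (altTail (suc k) m)))
  where open +-*-Solver

sub-≤ : ∀ {p q} → 0ℚ ≤ q → p - q ≤ p
sub-≤ {p} {q} 0≤q = subst (p - q ≤_) (+-identityʳ p) (+-monoʳ-≤ p (neg-antimono-≤ 0≤q))

0≤-sub : ∀ {p q} → q ≤ p → 0ℚ ≤ p - q
0≤-sub {p} {q} q≤p = subst (_≤ p - q) (+-inverseʳ q) (+-monoˡ-≤ (- q) q≤p)

altTail-bounds : ∀ k m → 0ℚ ≤ altTail k m × altTail k m ≤ absTerm k
altTail-bounds k zero    = ≤-refl , 0≤-/ 4 (2 ℕ.* k)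
altTail-bounds k (suc m) with altTail-bounds (suc k) m
... | 0≤t , t≤a = 0≤-sub (≤-trans t≤a (absTerm-antimono (ℕ.n≤1+n k))) , sub-≤ 0≤t

∣sign∣ : ∀ k → ∣ (- 1ℚ) ^ k ∣ ≡ 1ℚ
∣sign∣ zero    = refl
∣sign∣ (suc k) = trans (∣p*q∣≡∣p∣*∣q∣ (- 1ℚ) ((- 1ℚ) ^ k)) (trans (*-identityˡ _) (∣sign∣ k))

leibnizSum-close : ∀ k m → ∣ leibnizSum (m ℕ.+ k) - leibnizSum k ∣ ≤ absTerm k
leibnizSum-close k m = begin
  ∣ leibnizSum (m ℕ.+ k) - leibnizSum k ∣
    ≡⟨ cong (λ s → ∣ s - leibnizSum k ∣) (leibnizSum-+ k m) ⟩
  ∣ leibnizSum k + (- 1ℚ) ^ k * altTail k m - leibnizSum k ∣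
    ≡⟨ cong ∣_∣ (solve 2 (λ s d → (s :+ d) :- s := d) refl (leibnizSum k) ((- 1ℚ) ^ k * altTail k m)) ⟩
  ∣ (- 1ℚ) ^ k * altTail k m ∣       ≡⟨ ∣p*q∣≡∣p∣*∣q∣ ((- 1ℚ) ^ k) (altTail k m) ⟩
  ∣ (- 1ℚ) ^ k ∣ * ∣ altTail k m ∣   ≡⟨ cong₂ _*_ (∣sign∣ k) (0≤p⇒∣p∣≡p (proj₁ (altTail-bounds k m))) ⟩
  1ℚ * altTail k m                   ≡⟨ *-identityˡ (altTail k m) ⟩
  altTail k m                        ≤⟨ proj₂ (altTail-bounds k m) ⟩
  absTerm k                          ∎
  where
  open ≤-Reasoning
  open +-*-Solver

leibnizSum-close′ : ∀ {k n} → k ℕ.≤ n → ∣ leibnizSum n - leibnizSum k ∣ ≤ absTerm k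
leibnizSum-close′ {k} {n} k≤n = subst (λ i → ∣ leibnizSum i - leibnizSum k ∣ ≤ absTerm k)
  (ℕ.m∸n+n≡m k≤n) (leibnizSum-close k (n ℕ.∸ k))

-- 4 (1 - 1/3 + 1/5 - 1/7 + ⋯)
π : ℝ
π = mkℝ leibnizSum λ ε 0<ε →
  let N , small = archimedean 4 0<ε
      absTerm<ε : ∀ {k} → N ℕ.≤ k → absTerm k < ε
      absTerm<ε {k} N≤k = small (ℕ.≤-trans N≤k (ℕ.m≤m+n k (k ℕ.+ 0)))
      close : ∀ m n → N ℕ.≤ m → m ℕ.≤ n → ∣ leibnizSum n - leibnizSum m ∣ < ε
      close m n N≤m m≤n = ≤-<-trans (leibnizSum-close′ m≤n) (absTerm<ε N≤m)
  in N , λ m n N≤m N≤n → case (ℕ.≤-total m n) of λ where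
    (inj₁ m≤n) → subst (_< ε) (swap-∣-∣ (leibnizSum n) (leibnizSum m)) (close m n N≤m m≤n)
    (inj₂ n≤m) → close n m N≤n n≤m

0<π : 0ᴿ <ᴿ π
0<π = absTerm 0 - absTerm 1 , positive⁻¹ (absTerm 0 - absTerm 1) , 1 , bound
  where
  open ≤-Reasoning
  open +-*-Solver
  bound : ∀ n → 1 ℕ.≤ n → 0ℚ + (absTerm 0 - absTerm 1) ≤ leibnizSum n
  bound (suc n) _ = begin
    0ℚ + (absTerm 0 - absTerm 1)  ≡⟨ +-identityˡ (absTerm 0 - absTerm 1) ⟩
    absTerm 0 - absTerm 1
      ≤⟨ +-monoʳ-≤ (absTerm 0) (neg-antimono-≤ (proj₂ (altTail-bounds 1 n))) ⟩
    altTail 0 (suc n)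
      ≡⟨ solve 1 (λ t → t := con 0ℚ :+ con 1ℚ :* t) refl (altTail 0 (suc n)) ⟩
    0ℚ + 1ℚ * altTail 0 (suc n)   ≡⟨ leibnizSum-+ 0 (suc n) ⟨
    leibnizSum (suc n ℕ.+ 0)      ≡⟨ cong leibnizSum (ℕ.+-identityʳ (suc n)) ⟩
    leibnizSum (suc n)            ∎

-- n ^ (k / 2), that is √(n ^ k); for n = 0 and k < 0 it is the junk value 0.
_^½_ : ℕ → ℤ → ℝ
n ^½ k = √ ι (fromℕ n ^ℤ k)

-- a n / f n → 1 as n → ∞ through the n satisfying P, with the division by f n cleared.
_∼_along_ : (ℕ → ℝ) → (ℕ → ℝ) → (ℕ → Set) → Set
a ∼ f along P = ∀ ε → 0ᴿ <ᴿ ε →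
  ∃[ N ] (∀ n → N ℕ.≤ n → P n → ∣ a n -ᴿ f n ∣ᴿ ≤ᴿ ε *ᴿ ∣ f n ∣ᴿ)

{-# OPTIONS --safe #-}
module Submission where

-- Let f(r, n, q) be the number of forests of r trees with n nodes, q of them unary. Removing the
-- root of the first tree gives
--   f(r+1, n+1, q) = f(r, n, q) + f(r+2, n, q) + f(r+1, n, q-1),
-- solved by f(r, n, q) = r (n-1)! / (k! (k+r)! q!) with n = 2k + r + q. For r = 1 the count is
-- (2k+q)! / (k! (k+1)! q!), so the asymptotics reduce to that of C(2k, k) / 4^k, that is, to
-- Wallis' product. The latter is tied to the Leibniz series defining π by the partial fraction
-- expansion of 1 / ∏_{|j| ≤ M} (x - j) at x = 1/2: it expresses Wallis' product as the alternating
-- sum of (C(2M, M+i) + C(2M, M+i+1)) / (C(2M, M) (2i+1)), whose weights tend to 2 as M → ∞.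

-- Forests are counted because removing the root of a single tree leaves a pair of trees and hence a
-- convolution, whereas in a forest the children simply join the list and the recursion stays linear
-- in the counts. The partial fraction expansion itself never appears: an explicit telescoping
-- certificate shows that the alternating sum satisfies the recurrence of the inverse Wallis
-- product. On the analytic side, the claimed equivalent contains two square roots, which are given
-- only as sequences of rational approximations. Squaring removes them: the square of count over
-- equivalent, with π replaced by its `m`-th partial sum, is a rational expression in `k` and `m`.
-- The order of quantifiers dictates the rest. The bound on `n` must be found before the index `m`
-- of the approximations starts to grow, so convergence to 1 is needed jointly in `k` and `m`; the
-- error of the approximate roots need only vanish for fixed `n`.

module Counting where

  open import Data.Fin.Base using (Fin)
  open import Data.Fin.Permutation using (↔⇒≡)
  open import Data.Fin.Properties using (+↔⊎; 0↔⊥; 1↔⊤)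
  open import Data.Nat.Base
  open import Data.Nat.DivMod using ([m+kn]%n≡m%n)
  open import Data.Nat.Properties
  open import Data.Nat.Tactic.RingSolver using (solve-∀)
  open import Data.Product.Base using (Σ-syntax; ∃-syntax; _×_; _,_; proj₁; proj₂)
  open import Data.Sum.Base using (_⊎_; inj₁; inj₂)
  open import Data.Sum.Function.Propositional using (_⊎-↔_)
  open import Data.Unit.Base using (tt)
  open import Data.Vec.Base using (Vec; []; _∷_)
  open import Function.Base using (_∘_)
  open import Function.Bundles using (_↔_; mk↔ₛ′)
  open import Function.Construct.Composition using (_↔-∘_)
  open import Function.Construct.Symmetry using (↔-sym)
  open import Relation.Binary.PropositionalEquality
  open import Relation.Nullary using (¬_; contradiction)
  open import Defs using (Motzkin; leaf; unary; binary; size; unaries; MotzkinOf; MotzkinOf-finite; motzkinCount)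

  -- Forests with given numbers of nodes and unary nodes

  sizes unariesOf : ∀ {r} → Vec Motzkin r → ℕ
  sizes []           = 0
  sizes (t ∷ ts)     = size t + sizes ts
  unariesOf []       = 0
  unariesOf (t ∷ ts) = unaries t + unariesOf ts

  ForestOf : ℕ → ℕ → ℕ → Set
  ForestOf r n q = Σ[ ts ∈ Vec Motzkin r ] sizes ts ≡ n × unariesOf ts ≡ q

  forest-≡ : ∀ {r n q} {F G : ForestOf r n q} → proj₁ F ≡ proj₁ G → F ≡ G
  forest-≡ {F = ts , a , b} {G = .ts , a′ , b′} refl =
    cong (ts ,_) (cong₂ _,_ (≡-irrelevant a a′) (≡-irrelevant b b′))

  -- Parity of the size

  binaries : Motzkin → ℕ
  binaries leaf         = 0
  binaries (unary t)    = binaries t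
  binaries (binary l r) = suc (binaries l + binaries r)

  -- Leaves outnumber binary nodes by one, so together these two kinds of nodes are odd in number.
  size-parity : ∀ t → size t ≡ suc (unaries t) + binaries t * 2
  size-parity leaf      = refl
  size-parity (unary t) = cong suc (size-parity t)
  size-parity (binary l r) rewrite size-parity l | size-parity r =
    arith (unaries l) (unaries r) (binaries l) (binaries r)
    where
    arith : ∀ a b c d →
      suc (suc a + c * 2 + (suc b + d * 2)) ≡ suc (a + b) + suc (c + d) * 2
    arith = solve-∀

  n%2≢1+n%2 : ∀ n → n % 2 ≢ suc n % 2
  n%2≢1+n%2 zero          ()
  n%2≢1+n%2 (suc zero)    ()
  n%2≢1+n%2 (suc (suc n)) eq = n%2≢1+n%2 n eq

  -- `motzkinCount` is the length of a deduplicated enumeration, which is awkward to compute with.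
  -- Finite cardinalities being unique, any other bijection with a `Fin c` determines it.
  motzkinCount-unique : ∀ {n q c} → MotzkinOf n q ↔ Fin c → motzkinCount n q ≡ c
  motzkinCount-unique {n} {q} b = ↔⇒≡ (b ↔-∘ ↔-sym (proj₂ (MotzkinOf-finite n q)))

  empty↔Fin0 : ∀ {A : Set} → ¬ A → A ↔ Fin 0
  empty↔Fin0 ¬a = ↔-sym 0↔⊥ ↔-∘ mk↔ₛ′ ¬a (λ ()) (λ ()) (λ a → contradiction a ¬a)

  motzkinCount-parity : ∀ q n → n % 2 ≡ q % 2 → motzkinCount n q ≡ 0
  motzkinCount-parity q n n≡q = motzkinCount-unique (empty↔Fin0 none)
    where
    none : ¬ MotzkinOf n q
    none (t , refl , refl) = n%2≢1+n%2 (unaries t) (trans (sym n≡q)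
      (trans (cong (_% 2) (size-parity t)) ([m+kn]%n≡m%n (suc (unaries t)) (binaries t) 2)))

  -- Forest counts by removing a root

  forestCount : ℕ → ℕ → ℕ → ℕ
  forestCount zero    zero    zero    = 1
  forestCount zero    zero    (suc q) = 0
  forestCount zero    (suc n) q       = 0
  forestCount (suc r) zero    q       = 0
  forestCount (suc r) (suc n) zero    = forestCount r n 0 + forestCount (2 + r) n 0
  forestCount (suc r) (suc n) (suc q) =
    forestCount r n (suc q) + (forestCount (2 + r) n (suc q) + forestCount (suc r) n q)

  split-root₀ : ∀ {r n} →
    ForestOf (suc r) (suc n) 0 ↔ (ForestOf r n 0 ⊎ ForestOf (2 + r) n 0)
  split-root₀ = mk↔ₛ′
    (λ { (leaf ∷ ts , a , b) → inj₁ (ts , suc-injective a , b)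
       ; (unary t ∷ ts , a , ())
       ; (binary l r ∷ ts , a , b) → inj₂ (l ∷ r ∷ ts
           , trans (sym (+-assoc (size l) (size r) (sizes ts))) (suc-injective a)
           , trans (sym (+-assoc (unaries l) (unaries r) (unariesOf ts))) b) })
    (λ { (inj₁ (ts , a , b)) → leaf ∷ ts , cong suc a , b
       ; (inj₂ (l ∷ r ∷ ts , a , b)) → binary l r ∷ ts
           , cong suc (trans (+-assoc (size l) (size r) (sizes ts)) a)
           , trans (+-assoc (unaries l) (unaries r) (unariesOf ts)) b })
    (λ { (inj₁ _) → cong inj₁ (forest-≡ refl)
       ; (inj₂ (l ∷ r ∷ ts , a , b)) → cong inj₂ (forest-≡ refl) })
    (λ { (leaf ∷ ts , a , b) → forest-≡ refl
       ; (unary t ∷ ts , a , ())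
       ; (binary l r ∷ ts , a , b) → forest-≡ refl })

  split-root : ∀ {r n q} → ForestOf (suc r) (suc n) (suc q) ↔
    (ForestOf r n (suc q) ⊎ (ForestOf (2 + r) n (suc q) ⊎ ForestOf (suc r) n q))
  split-root = mk↔ₛ′
    (λ { (leaf ∷ ts , a , b) → inj₁ (ts , suc-injective a , b)
       ; (unary t ∷ ts , a , b) → inj₂ (inj₂ (t ∷ ts , suc-injective a , suc-injective b))
       ; (binary l r ∷ ts , a , b) → inj₂ (inj₁ (l ∷ r ∷ ts
           , trans (sym (+-assoc (size l) (size r) (sizes ts))) (suc-injective a)
           , trans (sym (+-assoc (unaries l) (unaries r) (unariesOf ts))) b)) })
    (λ { (inj₁ (ts , a , b)) → leaf ∷ ts , cong suc a , b
       ; (inj₂ (inj₂ (t ∷ ts , a , b))) → unary t ∷ ts , cong suc a , cong suc b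
       ; (inj₂ (inj₁ (l ∷ r ∷ ts , a , b))) → binary l r ∷ ts
           , cong suc (trans (+-assoc (size l) (size r) (sizes ts)) a)
           , trans (+-assoc (unaries l) (unaries r) (unariesOf ts)) b })
    (λ { (inj₁ _) → cong inj₁ (forest-≡ refl)
       ; (inj₂ (inj₂ (t ∷ ts , a , b))) → cong (λ F → inj₂ (inj₂ F)) (forest-≡ refl)
       ; (inj₂ (inj₁ (l ∷ r ∷ ts , a , b))) → cong (λ F → inj₂ (inj₁ F)) (forest-≡ refl) })
    (λ { (leaf ∷ ts , a , b) → forest-≡ refl
       ; (unary t ∷ ts , a , b) → forest-≡ refl
       ; (binary l r ∷ ts , a , b) → forest-≡ refl })

  0<size : ∀ t → 0 < size t
  0<size leaf         = z<s
  0<size (unary t)    = z<s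
  0<size (binary l r) = z<s

  forestCount-correct : ∀ r n q → ForestOf r n q ↔ Fin (forestCount r n q)
  forestCount-correct zero zero zero = ↔-sym 1↔⊤ ↔-∘
    mk↔ₛ′ (λ _ → tt) (λ _ → [] , refl , refl) (λ _ → refl) (λ { ([] , _) → forest-≡ refl })
  forestCount-correct zero zero (suc q) = empty↔Fin0 λ { ([] , _ , ()) }
  forestCount-correct zero (suc n) q    = empty↔Fin0 λ { ([] , () , _) }
  forestCount-correct (suc r) zero q    = empty↔Fin0 λ
    { (t ∷ ts , a , _) → m+n≢0 (0<size t) a }
    where
    m+n≢0 : ∀ {m n} → 0 < m → m + n ≢ 0
    m+n≢0 (s≤s _) ()
  forestCount-correct (suc r) (suc n) zero =
    (↔-sym +↔⊎ ↔-∘ (forestCount-correct r n 0 ⊎-↔ forestCount-correct (2 + r) n 0))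
      ↔-∘ split-root₀
  forestCount-correct (suc r) (suc n) (suc q) =
    (↔-sym +↔⊎ ↔-∘ (forestCount-correct r n (suc q) ⊎-↔
      (↔-sym +↔⊎ ↔-∘ (forestCount-correct (2 + r) n (suc q) ⊎-↔ forestCount-correct (suc r) n q))))
      ↔-∘ split-root

  tree↔forest : ∀ {n q} → MotzkinOf n q ↔ ForestOf 1 n q
  tree↔forest = mk↔ₛ′
    (λ (t , a , b) → t ∷ [] , trans (+-identityʳ _) a , trans (+-identityʳ _) b)
    (λ { (t ∷ [] , a , b) → t , trans (sym (+-identityʳ _)) a , trans (sym (+-identityʳ _)) b })
    (λ { (t ∷ [] , a , b) → forest-≡ refl })
    (λ (t , a , b) → cong (t ,_) (cong₂ _,_ (≡-irrelevant _ a) (≡-irrelevant _ b)))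

  motzkinCount≡forestCount : ∀ n q → motzkinCount n q ≡ forestCount 1 n q
  motzkinCount≡forestCount n q =
    motzkinCount-unique (forestCount-correct 1 n q ↔-∘ tree↔forest)

  -- Closed form of the forest counts

  forestCount-few-nodes : ∀ r n q → n < r + q → forestCount r n q ≡ 0
  forestCount-few-nodes zero    zero    (suc q) _ = refl
  forestCount-few-nodes zero    (suc n) q       _ = refl
  forestCount-few-nodes (suc r) zero    q       _ = refl
  -- Removing a root lowers the number of nodes by one and `r + q` by at most one, so the strict
  -- inequality survives.
  forestCount-few-nodes (suc r) (suc n) zero    (s≤s n<r) =
    cong₂ _+_ (forestCount-few-nodes r n 0 n<r)
              (forestCount-few-nodes (2 + r) n 0 (m≤n⇒m≤1+n (m≤n⇒m≤1+n n<r)))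
  forestCount-few-nodes (suc r) (suc n) (suc q) (s≤s n<r+q) =
    cong₂ _+_ (forestCount-few-nodes r n (suc q) n<r+q) (cong₂ _+_
      (forestCount-few-nodes (2 + r) n (suc q) (m≤n⇒m≤1+n (m≤n⇒m≤1+n n<r+q)))
      (forestCount-few-nodes (suc r) n q (subst (n <_) (+-suc r q) n<r+q)))

  -- The factor `n` on the left replaces the factorial of `n - 1`, so that nothing is subtracted. In
  -- the inductive step for `r + 1` trees, the three kinds of root contribute `(k + r + 1) r`,
  -- `k (r + 2)` and `q (r + 1)`, which add up to `(r + 1) (2k + r + q)`; the last factor is `n` and
  -- cancels.
  forestCount-closed : ∀ n r k q → n ≡ 2 * k + (r + q) →
    forestCount r n q * (k ! * (k + r) ! * q !) * n ≡ r * n !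
  forestCount-closed zero    zero    k q eq = *-zeroʳ (forestCount 0 0 q * (k ! * (k + 0) ! * q !))
  forestCount-closed (suc n) zero    k q eq = refl
  forestCount-closed zero    (suc r) k q eq = contradiction (trans eq (+-suc (2 * k) (r + q))) λ ()
  -- A single node is treated apart because the inductive step cancels the number of remaining
  -- nodes, which is zero here.
  forestCount-closed (suc zero)    (suc r) k q eq = base k r q (suc-injective (trans eq (+-suc (2 * k) (r + q))))
    where
    base : ∀ k r q → 0 ≡ 2 * k + (r + q) →
      forestCount (suc r) 1 q * (k ! * (k + suc r) ! * q !) * 1 ≡ suc r * 1
    base zero zero zero _ = refl
  forestCount-closed (suc n@(suc _)) (suc r) k q eq = step q refl
    where
    n≡ : n ≡ 2 * k + (r + q)
    n≡ = suc-injective (trans eq (+-suc (2 * k) (r + q)))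

    D = k ! * (k + suc r) ! * q !

    leaf-root : forestCount r n q * D * n ≡ (k + suc r) * r * n !
    leaf-root = begin
      f * (k ! * (k + suc r) ! * q !) * n
        ≡⟨ cong (λ j → f * (k ! * j ! * q !) * n) (+-suc k r) ⟩
      f * (k ! * (suc (k + r) * (k + r) !) * q !) * n
        ≡⟨ arith f (k !) (k + r) ((k + r) !) (q !) n ⟩
      suc (k + r) * (f * (k ! * (k + r) ! * q !) * n)
        ≡⟨ cong (suc (k + r) *_) (forestCount-closed n r k q n≡) ⟩
      suc (k + r) * (r * n !)
        ≡⟨ cong (_* (r * n !)) (+-suc k r) ⟨
      (k + suc r) * (r * n !)
        ≡⟨ *-assoc (k + suc r) r (n !) ⟨
      (k + suc r) * r * n ! ∎
      where
      open ≡-Reasoning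
      f = forestCount r n q
      arith : ∀ f a j b c n → f * (a * (suc j * b) * c) * n ≡ suc j * (f * (a * b * c) * n)
      arith = solve-∀

    binary-root : ∀ k → n ≡ 2 * k + (r + q) →
      forestCount (2 + r) n q * (k ! * (k + suc r) ! * q !) * n ≡ k * (2 + r) * n !
    -- For `k = 0` only `r + q` nodes remain, too few for `r + 2` trees with `q` unary nodes.
    binary-root zero n≡ = cong (λ f → f * (1 * (suc r) ! * q !) * n)
      (forestCount-few-nodes (2 + r) n q (s≤s (m≤n⇒m≤1+n (≤-reflexive n≡))))
    binary-root (suc k) n≡ = begin
      f * (suc k * k ! * (suc k + suc r) ! * q !) * n
        ≡⟨ arith f (suc k) (k !) ((suc k + suc r) !) (q !) n ⟩
      suc k * (f * (k ! * (suc k + suc r) ! * q !) * n)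
        ≡⟨ cong (λ j → suc k * (f * (k ! * j ! * q !) * n)) (+-suc k (suc r)) ⟨
      suc k * (f * (k ! * (k + (2 + r)) ! * q !) * n)
        ≡⟨ cong (suc k *_) (forestCount-closed n (2 + r) k q (trans n≡ (arith′ k (r + q)))) ⟩
      suc k * ((2 + r) * n !)
        ≡⟨ *-assoc (suc k) (2 + r) (n !) ⟨
      suc k * (2 + r) * n ! ∎
      where
      open ≡-Reasoning
      f = forestCount (2 + r) n q
      arith : ∀ f x a b c n → f * (x * a * b * c) * n ≡ x * (f * (a * b * c) * n)
      arith = solve-∀
      arith′ : ∀ k s → 2 * suc k + s ≡ 2 * k + suc (suc s)
      arith′ = solve-∀

    unary-root : ∀ q → n ≡ 2 * k + (r + suc q) →
      forestCount (suc r) n q * (k ! * (k + suc r) ! * (suc q) !) * n ≡ suc q * suc r * n !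
    unary-root q n≡ = begin
      f * (k ! * (k + suc r) ! * (suc q * q !)) * n
        ≡⟨ arith f (k !) ((k + suc r) !) (suc q) (q !) n ⟩
      suc q * (f * (k ! * (k + suc r) ! * q !) * n)
        ≡⟨ cong (suc q *_) (forestCount-closed n (suc r) k q (trans n≡ (cong (2 * k +_) (+-suc r q)))) ⟩
      suc q * (suc r * n !)
        ≡⟨ *-assoc (suc q) (suc r) (n !) ⟨
      suc q * suc r * n ! ∎
      where
      open ≡-Reasoning
      f = forestCount (suc r) n q
      arith : ∀ f a b x c n → f * (a * b * (x * c)) * n ≡ x * (f * (a * b * c) * n)
      arith = solve-∀

    combine : ∀ F₁ F₂ F₃ → F₁ * D * n ≡ (k + suc r) * r * n ! → F₂ * D * n ≡ k * (2 + r) * n ! →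
      F₃ * D * n ≡ q * suc r * n ! → (F₁ + (F₂ + F₃)) * D * suc n ≡ suc r * (suc n) !
    combine F₁ F₂ F₃ eq₁ eq₂ eq₃ = trans (cong (_* suc n) (*-cancelʳ-≡ ((F₁ + (F₂ + F₃)) * D) (suc r * n !) n (begin
      (F₁ + (F₂ + F₃)) * D * n               ≡⟨ arith F₁ F₂ F₃ D n ⟩
      F₁ * D * n + (F₂ * D * n + F₃ * D * n) ≡⟨ cong₂ _+_ eq₁ (cong₂ _+_ eq₂ eq₃) ⟩
      (k + suc r) * r * n ! + (k * (2 + r) * n ! + q * suc r * n !)
                                             ≡⟨ arith′ k r q (n !) ⟩
      suc r * n ! * (2 * k + (r + q))        ≡⟨ cong (suc r * n ! *_) n≡ ⟨
      suc r * n ! * n                        ∎))) (arith″ (suc r) (n !) (suc n))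
      where
      open ≡-Reasoning
      arith : ∀ a b c d n → (a + (b + c)) * d * n ≡ a * d * n + (b * d * n + c * d * n)
      arith = solve-∀
      arith′ : ∀ k r q x → (k + suc r) * r * x + (k * (2 + r) * x + q * suc r * x)
                         ≡ suc r * x * (2 * k + (r + q))
      arith′ = solve-∀
      arith″ : ∀ a b c → a * b * c ≡ a * (c * b)
      arith″ = solve-∀

    -- Splitting through `p ≡ q` exposes the two shapes of `forestCount` while `D` and the three
    -- contributions stay stated for `q`. For `q = 0` the absent unary summand is supplied as zero.
    step : ∀ p → p ≡ q → forestCount (suc r) (suc n) q * D * suc n ≡ suc r * (suc n) !
    step zero refl = trans
      (cong (λ f → (forestCount r n 0 + f) * D * suc n) (sym (+-identityʳ (forestCount (2 + r) n 0))))
      (combine (forestCount r n 0) (forestCount (2 + r) n 0) 0 leaf-root (binary-root k n≡) refl)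
    step (suc p) refl = combine (forestCount r n q) (forestCount (2 + r) n q) (forestCount (suc r) n p)
      leaf-root (binary-root k n≡) (unary-root p n≡)

  motzkinCount-closed : ∀ k q →
    motzkinCount (suc (2 * k + q)) q * (k ! * (suc k) ! * q !) ≡ (2 * k + q) !
  motzkinCount-closed k q = *-cancelʳ-≡ (motzkinCount (suc m) q * (k ! * (suc k) ! * q !)) (m !) (suc m) (begin
    motzkinCount (suc m) q * (k ! * (suc k) ! * q !) * suc m
      ≡⟨ cong₂ (λ f j → f * (k ! * j ! * q !) * suc m)
           (motzkinCount≡forestCount (suc m) q) (sym (trans (+-suc k 0) (cong suc (+-identityʳ k)))) ⟩
    forestCount 1 (suc m) q * (k ! * (k + 1) ! * q !) * suc m
      ≡⟨ forestCount-closed (suc m) 1 k q (sym (+-suc (2 * k) q)) ⟩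
    1 * (suc m) !
      ≡⟨ *-identityˡ ((suc m) !) ⟩
    suc m * m !
      ≡⟨ *-comm (suc m) (m !) ⟩
    m ! * suc m ∎)
    where
    open ≡-Reasoning
    m = 2 * k + q

  opposite-parity : ∀ {n q} → q < n → n % 2 ≢ q % 2 → ∃[ k ] (n ≡ suc (2 * k + q))
  opposite-parity {n} {q} q<n n≢q = let k , d≡2k = even-gap (n ∸ suc q) (n≢q ∘ trans (cong (_% 2) n≡))
    in k , trans n≡ (cong (λ d → suc (d + q)) d≡2k)
    where
    n≡ : n ≡ suc ((n ∸ suc q) + q)
    n≡ = trans (sym (m∸n+n≡m q<n)) (+-suc (n ∸ suc q) q)

    even-gap : ∀ d → suc (d + q) % 2 ≢ q % 2 → ∃[ k ] (d ≡ 2 * k)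
    even-gap zero          _  = 0 , refl
    even-gap (suc zero)    ≢q = contradiction refl ≢q
    -- Adding two leaves the remainder mod 2 unchanged by computation, so the hypothesis is passed
    -- on as it is.
    even-gap (suc (suc d)) ≢q = let k , d≡2k = even-gap d ≢q
      in suc k , trans (cong (2 +_) d≡2k) (sym (*-suc 2 k))

module Asymptotics where

  open import Data.Integer.Base as ℤ using (+_; -[1+_])
  import Data.Integer.Properties as ℤ
  open import Data.Nat.Base as ℕ using (ℕ; zero; suc; z≤n; s≤s)
  import Data.Nat.Properties as ℕ
  open import Data.Product.Base using (∃-syntax; _×_; _,_; proj₁; proj₂)
  open import Data.Rational.Base
  open import Data.Rational.Properties
  open import Data.Sum.Base using (inj₁; inj₂)
  open import Function.Base using (_∘_)
  open import Level using (0ℓ)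
  open import Relation.Binary.PropositionalEquality
  open import Relation.Nullary.Decidable using (dec⇒maybe)
  open import Tactic.RingSolver using (solve-∀)
  open import Tactic.RingSolver.Core.AlmostCommutativeRing using (AlmostCommutativeRing; fromCommutativeRing)
  open import Defs
  open Counting using (motzkinCount-closed; opposite-parity)

  -- Rational arithmetic

  ℚ-ring : AlmostCommutativeRing 0ℓ 0ℓ
  ℚ-ring = fromCommutativeRing +-*-commutativeRing λ p → dec⇒maybe (0ℚ ≟ p)

  4ℚ : ℚ
  4ℚ = + 4 / 1

  0<4 : 0ℚ < 4ℚ
  0<4 = positive⁻¹ 4ℚ

  fromℕ-+ : ∀ m n → fromℕ (m ℕ.+ n) ≡ fromℕ m + fromℕ n
  fromℕ-+ zero    n = sym (+-identityˡ (fromℕ n))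
  fromℕ-+ (suc m) n = trans (fromℕ-suc (m ℕ.+ n)) (trans (cong (_+ 1ℚ) (fromℕ-+ m n))
    (trans (arith (fromℕ m) (fromℕ n)) (cong (_+ fromℕ n) (sym (fromℕ-suc m)))))
    where
    arith : ∀ p q → p + q + 1ℚ ≡ p + 1ℚ + q
    arith = solve-∀ ℚ-ring

  0≤fromℕ : ∀ n → 0ℚ ≤ fromℕ n
  0≤fromℕ n = fromℕ-mono-≤ {0} {n} z≤n

  0<fromℕ-suc : ∀ n → 0ℚ < fromℕ (suc n)
  0<fromℕ-suc n = positive⁻¹ (fromℕ (suc n))

  fromℕ-∸ : ∀ {m n} → n ℕ.≤ m → fromℕ (m ℕ.∸ n) ≡ fromℕ m - fromℕ n
  fromℕ-∸ {m} {n} n≤m = trans (arith (fromℕ (m ℕ.∸ n)) (fromℕ n))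
    (cong (_- fromℕ n) (trans (sym (fromℕ-+ (m ℕ.∸ n) n)) (cong fromℕ (ℕ.m∸n+n≡m n≤m))))
    where
    arith : ∀ p q → p ≡ p + q - q
    arith = solve-∀ ℚ-ring

  *-nonNeg : ∀ {p q} → 0ℚ ≤ p → 0ℚ ≤ q → 0ℚ ≤ p * q
  *-nonNeg {p} {q} 0≤p 0≤q = subst (_≤ p * q) (*-zeroʳ p) (*-monoʳ-≤ {0ℚ} {q} {p} 0≤p 0≤q)

  *-cancelʳ-≤ : ∀ {p q} r → 0ℚ < r → p * r ≤ q * r → p ≤ q
  *-cancelʳ-≤ r 0<r = *-cancelʳ-≤-pos r {{positive 0<r}}

  *-cancelʳ-≡ : ∀ {p q} r → 0ℚ < r → p * r ≡ q * r → p ≡ q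
  *-cancelʳ-≡ r 0<r eq =
    ≤-antisym (*-cancelʳ-≤ r 0<r (≤-reflexive eq)) (*-cancelʳ-≤ r 0<r (≤-reflexive (sym eq)))

  p-q≡0⇒p≡q : ∀ {p q} → p - q ≡ 0ℚ → p ≡ q
  p-q≡0⇒p≡q {p} {q} eq = trans (arith p q) (trans (cong (_+ q) eq) (+-identityˡ q))
    where
    arith : ∀ p q → p ≡ p - q + q
    arith = solve-∀ ℚ-ring

  -- The ring solver cannot use hypotheses. Identities that depend on some are therefore proved by
  -- writing the difference of the two sides as an explicit combination of the differences of the
  -- hypotheses, each of which vanishes by this lemma.
  p≡q⇒r*[p-q]≡0 : ∀ {p q} r → p ≡ q → r * (p - q) ≡ 0ℚ
  p≡q⇒r*[p-q]≡0 {p} r refl = trans (cong (r *_) (+-inverseʳ p)) (*-zeroʳ r)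

  0≤p-q⇒q≤p : ∀ {p q} → 0ℚ ≤ p - q → q ≤ p
  0≤p-q⇒q≤p {p} {q} h = subst₂ _≤_ (+-identityˡ q) (arith p q) (+-monoˡ-≤ q h)
    where
    arith : ∀ p q → p - q + q ≡ p
    arith = solve-∀ ℚ-ring

  -- Alternating sums

  -- Peeling terms off the front avoids powers of -1 and agrees with the recursion of `altTail`.
  alternating : (ℕ → ℚ) → ℕ → ℚ
  alternating b zero    = 0ℚ
  alternating b (suc m) = b 0 - alternating (b ∘ suc) m

  alternating-bounds : ∀ {b} → (∀ i → 0ℚ ≤ b i) → (∀ i → b (suc i) ≤ b i) → ∀ m →
    0ℚ ≤ alternating b m × alternating b m ≤ b 0
  alternating-bounds     0≤b b↓ zero    = ≤-refl , 0≤b 0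
  alternating-bounds {b} 0≤b b↓ (suc m) with alternating-bounds (0≤b ∘ suc) (b↓ ∘ suc) m
  ... | 0≤t , t≤b₁ = 0≤-sub (≤-trans t≤b₁ (b↓ 0)) , sub-≤ {b 0} 0≤t

  -- Leibniz's remainder estimate: up to sign, what follows the first `K` terms is again an
  -- alternating sum, with leading term `b K`.
  alternating-tail : ∀ {b} → (∀ i → 0ℚ ≤ b i) → (∀ i → b (suc i) ≤ b i) → ∀ K d →
    ∣ alternating b (K ℕ.+ d) - alternating b K ∣ ≤ b K
  alternating-tail {b} 0≤b b↓ zero d with alternating-bounds 0≤b b↓ d
  ... | 0≤t , t≤b₀ = subst (_≤ b 0) (sym (trans (cong ∣_∣ (+-identityʳ t)) (0≤p⇒∣p∣≡p 0≤t))) t≤b₀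
    where t = alternating b d
  alternating-tail {b} 0≤b b↓ (suc K) d = subst (_≤ b (suc K))
    (trans (swap-∣-∣ x y) (cong ∣_∣ (arith (b 0) x y))) (alternating-tail (0≤b ∘ suc) (b↓ ∘ suc) K d)
    where
    x = alternating (b ∘ suc) (K ℕ.+ d)
    y = alternating (b ∘ suc) K
    arith : ∀ p x y → y - x ≡ p - x - (p - y)
    arith = solve-∀ ℚ-ring

  alternating-close : ∀ {b c e} K → (∀ i → i ℕ.< K → ∣ b i - c i ∣ ≤ e) →
    ∣ alternating b K - alternating c K ∣ ≤ fromℕ K * e
  alternating-close {e = e} zero close = ≤-reflexive (sym (*-zeroˡ e))
  alternating-close {b} {c} {e} (suc K) close = begin
    ∣ b 0 - x - (c 0 - y) ∣         ≡⟨ cong ∣_∣ (arith (b 0) x (c 0) y) ⟩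
    ∣ (b 0 - c 0) - (x - y) ∣       ≤⟨ ∣p-q∣≤∣p∣+∣q∣ (b 0 - c 0) (x - y) ⟩
    ∣ b 0 - c 0 ∣ + ∣ x - y ∣       ≤⟨ +-mono-≤ (close 0 (s≤s z≤n))
                                         (alternating-close K (λ i i<K → close (suc i) (s≤s i<K))) ⟩
    e + fromℕ K * e                 ≡⟨ arith′ e (fromℕ K) ⟩
    (fromℕ K + 1ℚ) * e              ≡⟨ cong (_* e) (fromℕ-suc K) ⟨
    fromℕ (suc K) * e               ∎
    where
    open ≤-Reasoning
    x = alternating (b ∘ suc) K
    y = alternating (c ∘ suc) K
    arith : ∀ p x q y → p - x - (q - y) ≡ (p - q) - (x - y)
    arith = solve-∀ ℚ-ring
    arith′ : ∀ e k → e + k * e ≡ (k + 1ℚ) * e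
    arith′ = solve-∀ ℚ-ring

  alternating-snoc-0 : ∀ b m → b m ≡ 0ℚ → alternating b (suc m) ≡ alternating b m
  alternating-snoc-0 b zero    b₀≡0 = trans (+-identityʳ (b 0)) b₀≡0
  alternating-snoc-0 b (suc m) bₘ≡0 = cong (λ s → b 0 - s) (alternating-snoc-0 (b ∘ suc) m bₘ≡0)

  -- Under alternating signs the sums `g i + g (suc i)` cancel down to the two boundary values of
  -- `g`. With a suitable `g` this compares two sums whose terms are not proportional.
  alternating-telescope : ∀ {b c g x y} m →
    (∀ i → i ℕ.< m → x * b i - y * c i ≡ g i + g (suc i)) → g 0 ≡ 0ℚ → g m ≡ 0ℚ →
    x * alternating b m ≡ y * alternating c m
  alternating-telescope {b} {c} {g} {x} {y} m term g₀≡0 gₘ≡0 =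
    p-q≡0⇒p≡q (trans (go m b c g term gₘ≡0) g₀≡0)
    where
    arith : ∀ x y b c s t → x * (b - s) - y * (c - t) ≡ x * b - y * c - (x * s - y * t)
    arith = solve-∀ ℚ-ring
    arith₀ : ∀ x y → x * 0ℚ - y * 0ℚ ≡ 0ℚ
    arith₀ = solve-∀ ℚ-ring
    arith₁ : ∀ p q → p + q - q ≡ p
    arith₁ = solve-∀ ℚ-ring
    go : ∀ m b c g → (∀ i → i ℕ.< m → x * b i - y * c i ≡ g i + g (suc i)) → g m ≡ 0ℚ →
      x * alternating b m - y * alternating c m ≡ g 0
    go zero    b c g term g₀≡0 = trans (arith₀ x y) (sym g₀≡0)
    go (suc m) b c g term gₘ≡0 = trans
      (arith x y (b 0) (c 0) (alternating (b ∘ suc) m) (alternating (c ∘ suc) m))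
      (trans (cong₂ _-_ (term 0 (s≤s z≤n))
               (go m (b ∘ suc) (c ∘ suc) (g ∘ suc) (λ i i<m → term (suc i) (s≤s i<m)) gₘ≡0))
             (arith₁ (g 0) (g 1)))

  leibnizSum≡alternating : ∀ m → leibnizSum m ≡ alternating absTerm m
  leibnizSum≡alternating m = trans (cong leibnizSum (sym (ℕ.+-identityʳ m)))
    (trans (leibnizSum-+ 0 m) (trans (arith (altTail 0 m))
      (altTail≡alternating 0 m absTerm λ i → cong absTerm (sym (ℕ.+-identityʳ i)))))
    where
    arith : ∀ t → 0ℚ + 1ℚ * t ≡ t
    arith = solve-∀ ℚ-ring
    altTail≡alternating : ∀ k m f → (∀ i → f i ≡ absTerm (i ℕ.+ k)) → altTail k m ≡ alternating f m
    altTail≡alternating k zero    f f≡ = refl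
    altTail≡alternating k (suc m) f f≡ = cong₂ _-_ (sym (f≡ 0)) (altTail≡alternating (suc k) m (f ∘ suc)
      λ i → trans (f≡ (suc i)) (cong absTerm (sym (ℕ.+-suc i k))))

  -- Wallis' product

  -- C(2M, M + i) / C(2M, M)
  weight : ℕ → ℕ → ℚ
  weight M zero    = 1ℚ
  weight M (suc i) = weight M i * (+ (M ℕ.∸ i) / suc (M ℕ.+ i))

  weight-suc : ∀ M i → weight M (suc i) * fromℕ (suc (M ℕ.+ i)) ≡ weight M i * fromℕ (M ℕ.∸ i)
  weight-suc M i = trans (*-assoc (weight M i) _ _) (cong (weight M i *_) (/-*-cancel (M ℕ.∸ i) (M ℕ.+ i)))

  0≤weight : ∀ M i → 0ℚ ≤ weight M i
  0≤weight M zero    = <⇒≤ 0<1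
  0≤weight M (suc i) = *-nonNeg (0≤weight M i) (0≤-/ (M ℕ.∸ i) (M ℕ.+ i))

  weight-antitone : ∀ M i → weight M (suc i) ≤ weight M i
  weight-antitone M i = *-cancelʳ-≤ (fromℕ (suc (M ℕ.+ i))) (0<fromℕ-suc (M ℕ.+ i))
    (≤-trans (≤-reflexive (weight-suc M i)) (*-monoʳ-≤ (0≤weight M i)
      (fromℕ-mono-≤ (ℕ.≤-trans (ℕ.m∸n≤m M i) (ℕ.≤-trans (ℕ.m≤m+n M i) (ℕ.n≤1+n (M ℕ.+ i)))))))

  weight≤1 : ∀ M i → weight M i ≤ 1ℚ
  weight≤1 M zero    = ≤-refl
  weight≤1 M (suc i) = ≤-trans (weight-antitone M i) (weight≤1 M i)

  weight-beyond : ∀ {M i} → M ℕ.≤ i → weight M (suc i) ≡ 0ℚ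
  weight-beyond {M} {i} M≤i = *-cancelʳ-≡ (fromℕ (suc (M ℕ.+ i))) (0<fromℕ-suc (M ℕ.+ i)) (begin
    weight M (suc i) * fromℕ (suc (M ℕ.+ i)) ≡⟨ weight-suc M i ⟩
    weight M i * fromℕ (M ℕ.∸ i)             ≡⟨ cong (λ d → weight M i * fromℕ d) (ℕ.m≤n⇒m∸n≡0 M≤i) ⟩
    weight M i * 0ℚ                          ≡⟨ *-zeroʳ (weight M i) ⟩
    0ℚ                                       ≡⟨ *-zeroˡ (fromℕ (suc (M ℕ.+ i))) ⟨
    0ℚ * fromℕ (suc (M ℕ.+ i))               ∎)
    where open ≡-Reasoning

  fromℕ-suc-+ : ∀ M i → fromℕ (suc (M ℕ.+ i)) ≡ fromℕ M + fromℕ i + 1ℚ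
  fromℕ-suc-+ M i = trans (fromℕ-suc (M ℕ.+ i)) (cong (_+ 1ℚ) (fromℕ-+ M i))

  fromℕ-1+2* : ∀ i → fromℕ (suc (2 ℕ.* i)) ≡ 1ℚ + (fromℕ i + fromℕ i)
  fromℕ-1+2* i = trans (fromℕ-suc-+ i (i ℕ.+ 0))
    (trans (cong (λ j → fromℕ i + fromℕ j + 1ℚ) (ℕ.+-identityʳ i)) (arith (fromℕ i)))
    where
    arith : ∀ p → p + p + 1ℚ ≡ 1ℚ + (p + p)
    arith = solve-∀ ℚ-ring

  -- The step from `i` to `i + 1` lowers the weight by at most `(2i + 1) / (M + 1)`, and the first
  -- `i` odd numbers add up to the square of `i`.
  1-weight-bound : ∀ M i → (1ℚ - weight M i) * fromℕ (suc M) ≤ fromℕ i * fromℕ i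
  1-weight-bound M zero    = ≤-reflexive (arith (fromℕ (suc M)))
    where
    arith : ∀ s → (1ℚ - 1ℚ) * s ≡ 0ℚ * 0ℚ
    arith = solve-∀ ℚ-ring
  1-weight-bound M (suc i) = begin
    (1ℚ - u′) * s                     ≡⟨ arith₁ u u′ s ⟩
    (1ℚ - u) * s + (u - u′) * s       ≤⟨ +-mono-≤ (1-weight-bound M i) drop ⟩
    I * I + (1ℚ + (I + I))            ≡⟨ arith₂ I ⟩
    (I + 1ℚ) * (I + 1ℚ)               ≡⟨ cong₂ _*_ (fromℕ-suc i) (fromℕ-suc i) ⟨
    fromℕ (suc i) * fromℕ (suc i)     ∎
    where
    open ≤-Reasoning
    u = weight M i
    u′ = weight M (suc i)
    s = fromℕ (suc M)
    m = fromℕ M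
    I = fromℕ i
    arith₁ : ∀ u u′ s → (1ℚ - u′) * s ≡ (1ℚ - u) * s + (u - u′) * s
    arith₁ = solve-∀ ℚ-ring
    arith₂ : ∀ I → I * I + (1ℚ + (I + I)) ≡ (I + 1ℚ) * (I + 1ℚ)
    arith₂ = solve-∀ ℚ-ring
    arith₃ : ∀ u u′ t → (u - u′) * t ≡ u * t - u′ * t
    arith₃ = solve-∀ ℚ-ring
    arith₄ : ∀ u t d → u * t - u * d ≡ u * (t - d)
    arith₄ = solve-∀ ℚ-ring
    arith₅ : ∀ m I d → m + I + 1ℚ - d ≡ 1ℚ + I + (m - d)
    arith₅ = solve-∀ ℚ-ring
    arith₆ : ∀ d I → I + d - d ≡ I
    arith₆ = solve-∀ ℚ-ring
    arith₇ : ∀ I → 1ℚ + I + I ≡ 1ℚ + (I + I)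
    arith₇ = solve-∀ ℚ-ring
    d = fromℕ (M ℕ.∸ i)
    m-d≤I : m - d ≤ I
    m-d≤I = begin
      m - d                           ≤⟨ +-monoˡ-≤ (- d) (fromℕ-mono-≤ (ℕ.m≤n+m∸n M i)) ⟩
      fromℕ (i ℕ.+ (M ℕ.∸ i)) - d     ≡⟨ cong (_- d) (fromℕ-+ i (M ℕ.∸ i)) ⟩
      I + d - d                       ≡⟨ arith₆ d I ⟩
      I                               ∎
    0≤1+2I : 0ℚ ≤ 1ℚ + (I + I)
    0≤1+2I = +-mono-≤ (<⇒≤ 0<1) (+-mono-≤ (0≤fromℕ i) (0≤fromℕ i))
    drop : (u - u′) * s ≤ 1ℚ + (I + I)
    drop = begin
      (u - u′) * s                    ≤⟨ *-monoʳ-≤ (0≤-sub (weight-antitone M i))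
                                           (fromℕ-mono-≤ (s≤s (ℕ.m≤m+n M i))) ⟩
      (u - u′) * fromℕ (suc (M ℕ.+ i)) ≡⟨ arith₃ u u′ _ ⟩
      u * fromℕ (suc (M ℕ.+ i)) - u′ * fromℕ (suc (M ℕ.+ i))
        ≡⟨ cong (λ t → u * fromℕ (suc (M ℕ.+ i)) - t) (weight-suc M i) ⟩
      u * fromℕ (suc (M ℕ.+ i)) - u * d ≡⟨ arith₄ u _ d ⟩
      u * (fromℕ (suc (M ℕ.+ i)) - d) ≡⟨ cong (λ t → u * (t - d)) (fromℕ-suc-+ M i) ⟩
      u * (m + I + 1ℚ - d)            ≡⟨ cong (u *_) (arith₅ m I d) ⟩
      u * (1ℚ + I + (m - d))          ≤⟨ *-monoʳ-≤ (0≤weight M i) (+-monoʳ-≤ (1ℚ + I) m-d≤I) ⟩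
      u * (1ℚ + I + I)                ≡⟨ cong (u *_) (arith₇ I) ⟩
      u * (1ℚ + (I + I))              ≤⟨ *-monoˡ-≤ 0≤1+2I (weight≤1 M i) ⟩
      1ℚ * (1ℚ + (I + I))             ≡⟨ *-identityˡ _ ⟩
      1ℚ + (I + I)                    ∎

  weight-suc-≤ : ∀ {M i} → i ℕ.≤ M →
    weight M (suc i) * (fromℕ M + fromℕ i + 1ℚ) ≡ weight M i * (fromℕ M - fromℕ i)
  weight-suc-≤ {M} {i} i≤M = trans (cong (weight M (suc i) *_) (sym (fromℕ-suc-+ M i)))
    (trans (weight-suc M i) (cong (weight M i *_) (fromℕ-∸ i≤M)))

  -- Comparing C(2M+2, M+1+i) with C(2M, M+i) gives the factor (2M+2)(2M+1) / ((M+1+i)(M+1-i));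
  -- dividing by its value at `i = 0` leaves the stated ratio. At `i = M + 1` both sides are zero.
  weight-cross : ∀ {M} i → i ℕ.≤ suc M → fromℕ (suc M) * fromℕ (suc M) * weight M i
    ≡ (fromℕ (suc M) * fromℕ (suc M) - fromℕ i * fromℕ i) * weight (suc M) i
  weight-cross {M} zero    _ = arith (fromℕ (suc M))
    where
    arith : ∀ s → s * s * 1ℚ ≡ (s * s - 0ℚ * 0ℚ) * 1ℚ
    arith = solve-∀ ℚ-ring
  weight-cross {M} (suc i) (s≤s i≤M) = trans (*-cancelʳ-≡ (m + I + 1ℚ)
      (subst (0ℚ <_) (fromℕ-suc-+ M i) (0<fromℕ-suc (M ℕ.+ i)))
      (p-q≡0⇒p≡q (trans (arith s m I V V′ U U′) (cong₂ _+_ (cong₂ _+_ (cong₂ _+_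
        (p≡q⇒r*[p-q]≡0 (s * s) (weight-suc-≤ i≤M))
        (p≡q⇒r*[p-q]≡0 (m - I) (weight-cross i (ℕ.m≤n⇒m≤1+n i≤M))))
        (p≡q⇒r*[p-q]≡0 (- ((m + I + 1ℚ) * (m - I))) (weight-suc-≤ {suc M} {i} (ℕ.m≤n⇒m≤1+n i≤M))))
        (p≡q⇒r*[p-q]≡0 (U * (m - I) * (s - I) - (m + I + 1ℚ) * (s + (I + 1ℚ)) * U′)
          (fromℕ-suc M))))))
    (cong (λ j → (s * s - j * j) * U′) (sym (fromℕ-suc i)))
    where
    s = fromℕ (suc M)
    m = fromℕ M
    I = fromℕ i
    V = weight M i
    V′ = weight M (suc i)
    U = weight (suc M) i
    U′ = weight (suc M) (suc i)
    arith : ∀ s m I V V′ U U′ →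
      s * s * V′ * (m + I + 1ℚ) - (s * s - (I + 1ℚ) * (I + 1ℚ)) * U′ * (m + I + 1ℚ)
      ≡ s * s * (V′ * (m + I + 1ℚ) - V * (m - I))
      + (m - I) * (s * s * V - (s * s - I * I) * U)
      + - ((m + I + 1ℚ) * (m - I)) * (U′ * (s + I + 1ℚ) - U * (s - I))
      + (U * (m - I) * (s - I) - (m + I + 1ℚ) * (s + (I + 1ℚ)) * U′) * (s - (m + 1ℚ))
    arith = solve-∀ ℚ-ring

  -- The poles `-i` and `i + 1` lie at the same distance from 1/2, and their partial fractions have
  -- equal signs there. They are merged into one term, whence the sum of two neighbouring weights.
  weightedTerm : ℕ → ℕ → ℚ
  weightedTerm M i = (weight M i + weight M (suc i)) * absTerm i

  weightedLeibniz : ℕ → ℚ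
  weightedLeibniz M = alternating (weightedTerm M) (suc M)

  -- `g` is a certificate in the style of Wilf and Zeilberger. It vanishes at 0 through the factor
  -- `j` and at `M + 2` through the weight, so the recurrence of `weightedLeibniz-suc`, multiplied
  -- by `s`, follows by telescoping.
  weightedTerm-telescope : ∀ M i → i ℕ.≤ suc M → let s = fromℕ (suc M)
                                                     g = λ j → - (4ℚ * ((s + s) - 1ℚ) * (fromℕ j * weight (suc M) j)) in
    4ℚ * (s * s * s) * weightedTerm M i - s * (4ℚ * (s * s) - 1ℚ) * weightedTerm (suc M) i ≡ g i + g (suc i)
  weightedTerm-telescope M i i≤1+M = trans
    (p-q≡0⇒p≡q (trans (arith s I U U′ V V′ o) (cong₂ _+_ (cong₂ _+_ (cong₂ _+_ (cong₂ _+_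
      (p≡q⇒r*[p-q]≡0 (4ℚ * s * o) (weight-cross i i≤1+M))
      (p≡q⇒r*[p-q]≡0 (4ℚ * s * o) cross-suc))
      (p≡q⇒r*[p-q]≡0 (s * ((1ℚ - (I + I)) * U - (I + I + (1ℚ + 1ℚ + 1ℚ)) * U′)) odd))
      (p≡q⇒r*[p-q]≡0 (- 4ℚ) (weight-suc-≤ i≤1+M))) refl)))
    (cong (λ j → - (4ℚ * ((s + s) - 1ℚ) * (I * U)) + - (4ℚ * ((s + s) - 1ℚ) * (j * U′))) (sym (fromℕ-suc i)))
    where
    s = fromℕ (suc M)
    I = fromℕ i
    V = weight M i
    V′ = weight M (suc i)
    U = weight (suc M) i
    U′ = weight (suc M) (suc i)
    o = absTerm i

    odd : o * (1ℚ + (I + I)) ≡ 4ℚ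
    odd = trans (cong (o *_) (sym (fromℕ-1+2* i))) (/-*-cancel 4 (2 ℕ.* i))

    cross-suc : s * s * V′ ≡ (s * s - (I + 1ℚ) * (I + 1ℚ)) * U′
    cross-suc with ℕ.m≤n⇒m<n∨m≡n i≤1+M
    ... | inj₁ i<1+M = trans (weight-cross (suc i) i<1+M) (cong (λ j → (s * s - j * j) * U′) (fromℕ-suc i))
    -- Here `suc i` is `M + 2`, outside the range of `weight-cross`, but the weights on both sides
    -- vanish.
    ... | inj₂ refl  = trans (cong (s * s *_) (weight-beyond {M} (ℕ.n≤1+n M)))
      (trans (arith₀ (s * s) (s * s - (I + 1ℚ) * (I + 1ℚ)))
             (cong ((s * s - (I + 1ℚ) * (I + 1ℚ)) *_) (sym (weight-beyond {suc M} ℕ.≤-refl))))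
      where
      arith₀ : ∀ p q → p * 0ℚ ≡ q * 0ℚ
      arith₀ = solve-∀ ℚ-ring

    arith : ∀ m i U U₁ V V₁ o →
      4ℚ * (m * m * m) * ((V + V₁) * o) - m * (4ℚ * (m * m) - 1ℚ) * ((U + U₁) * o)
        - (- (4ℚ * ((m + m) - 1ℚ) * (i * U)) + - (4ℚ * ((m + m) - 1ℚ) * ((i + 1ℚ) * U₁)))
      ≡ 4ℚ * m * o * (m * m * V - (m * m - i * i) * U)
       + 4ℚ * m * o * (m * m * V₁ - (m * m - (i + 1ℚ) * (i + 1ℚ)) * U₁)
       + m * ((1ℚ - (i + i)) * U - (i + i + (1ℚ + 1ℚ + 1ℚ)) * U₁) * (o * (1ℚ + (i + i)) - 4ℚ)
       + - 4ℚ * (U₁ * (m + i + 1ℚ) - U * (m - i)) + 0ℚ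
    arith = solve-∀ ℚ-ring

  weightedLeibniz-suc : ∀ M → let s = fromℕ (suc M) in
    4ℚ * (s * s) * weightedLeibniz M ≡ (4ℚ * (s * s) - 1ℚ) * weightedLeibniz (suc M)
  weightedLeibniz-suc M = *-cancelʳ-≡ s (0<fromℕ-suc M) (begin
    4ℚ * (s * s) * weightedLeibniz M * s
      ≡⟨ cong (λ t → 4ℚ * (s * s) * t * s) (alternating-snoc-0 (weightedTerm M) (suc M) last≡0) ⟨
    4ℚ * (s * s) * t * s                                 ≡⟨ arith₁ s t ⟩
    4ℚ * (s * s * s) * t
      ≡⟨ alternating-telescope {weightedTerm M} {weightedTerm (suc M)} {g}
           {4ℚ * (s * s * s)} {s * (4ℚ * (s * s) - 1ℚ)} (suc (suc M))
           (λ { i (s≤s i≤1+M) → weightedTerm-telescope M i i≤1+M }) (arith₃ s)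
           (trans (cong (λ w → - (4ℚ * ((s + s) - 1ℚ) * (fromℕ (suc (suc M)) * w))) (weight-beyond {suc M} ℕ.≤-refl))
             (arith₄ s (fromℕ (suc (suc M))))) ⟩
    s * (4ℚ * (s * s) - 1ℚ) * weightedLeibniz (suc M)    ≡⟨ arith₂ s (weightedLeibniz (suc M)) ⟩
    (4ℚ * (s * s) - 1ℚ) * weightedLeibniz (suc M) * s    ∎)
    where
    open ≡-Reasoning
    s = fromℕ (suc M)
    t = alternating (weightedTerm M) (suc (suc M))
    g : ℕ → ℚ
    g j = - (4ℚ * ((s + s) - 1ℚ) * (fromℕ j * weight (suc M) j))
    -- `weightedLeibniz M` is one term shorter than `weightedLeibniz (suc M)`; appending this zero
    -- term gives both sums the same length.
    last≡0 : weightedTerm M (suc M) ≡ 0ℚ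
    last≡0 = trans (cong₂ (λ v v′ → (v + v′) * absTerm (suc M))
      (weight-beyond {M} ℕ.≤-refl) (weight-beyond {M} (ℕ.n≤1+n M))) (*-zeroˡ (absTerm (suc M)))
    arith₁ : ∀ s t → 4ℚ * (s * s) * t * s ≡ 4ℚ * (s * s * s) * t
    arith₁ = solve-∀ ℚ-ring
    arith₂ : ∀ s t → s * (4ℚ * (s * s) - 1ℚ) * t ≡ (4ℚ * (s * s) - 1ℚ) * t * s
    arith₂ = solve-∀ ℚ-ring
    arith₃ : ∀ s → - (4ℚ * ((s + s) - 1ℚ) * (0ℚ * 1ℚ)) ≡ 0ℚ
    arith₃ = solve-∀ ℚ-ring
    arith₄ : ∀ s j → - (4ℚ * ((s + s) - 1ℚ) * (j * 0ℚ)) ≡ 0ℚ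
    arith₄ = solve-∀ ℚ-ring

  -- C(2k, k) / 4^k
  central : ℕ → ℚ
  central zero    = 1ℚ
  central (suc k) = central k * (+ suc (2 ℕ.* k) / suc (suc (2 ℕ.* k)))

  central-suc : ∀ k → central (suc k) * fromℕ (suc (suc (2 ℕ.* k))) ≡ central k * fromℕ (suc (2 ℕ.* k))
  central-suc k = trans (*-assoc (central k) _ _)
    (cong (central k *_) (/-*-cancel (suc (2 ℕ.* k)) (suc (2 ℕ.* k))))

  0<central : ∀ k → 0ℚ < central k
  0<central zero    = 0<1
  0<central (suc k) = *-pos (0<central k) (positive⁻¹ _ {{normalize-pos (suc (2 ℕ.* k)) (suc (suc (2 ℕ.* k)))}})

  fromℕ-1+2*suc : ∀ k → fromℕ (suc (2 ℕ.* suc k)) ≡ fromℕ (suc (2 ℕ.* k)) + 1ℚ + 1ℚ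
  fromℕ-1+2*suc k = trans (cong (λ j → fromℕ (suc j)) (ℕ.*-suc 2 k))
    (trans (fromℕ-suc (suc (suc (2 ℕ.* k)))) (cong (_+ 1ℚ) (fromℕ-suc (suc (2 ℕ.* k)))))

  central-suc-cleared : ∀ k → let a = fromℕ (suc (2 ℕ.* k)) in
    central (suc k) * (a + 1ℚ) ≡ central k * a
  central-suc-cleared k = trans (cong (central (suc k) *_) (sym (fromℕ-suc (suc (2 ℕ.* k))))) (central-suc k)

  -- This product decreases from 1: with `a = 2k + 1`, each step multiplies it by `a (a + 2)` over
  -- the square of `a + 1`.
  central²-bound : ∀ k → central k * central k * fromℕ (suc (2 ℕ.* k)) ≤ 1ℚ
  central²-bound zero    = ≤-refl
  central²-bound (suc k) = *-cancelʳ-≤ ((a + 1ℚ) * (a + 1ℚ)) (*-pos 0<a+1 0<a+1) (begin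
    c′ * c′ * fromℕ (suc (2 ℕ.* suc k)) * ((a + 1ℚ) * (a + 1ℚ))
      ≡⟨ cong (λ t → c′ * c′ * t * ((a + 1ℚ) * (a + 1ℚ))) (fromℕ-1+2*suc k) ⟩
    c′ * c′ * (a + 1ℚ + 1ℚ) * ((a + 1ℚ) * (a + 1ℚ))      ≡⟨ arith₁ a c′ ⟩
    (c′ * (a + 1ℚ)) * (c′ * (a + 1ℚ)) * (a + 1ℚ + 1ℚ)
      ≡⟨ cong (λ t → t * t * (a + 1ℚ + 1ℚ)) (central-suc-cleared k) ⟩
    (c * a) * (c * a) * (a + 1ℚ + 1ℚ)                    ≡⟨ arith₂ a c ⟩
    c * c * a * (a * (a + 1ℚ + 1ℚ))                      ≤⟨ *-monoˡ-≤ 0≤a[a+2] (central²-bound k) ⟩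
    1ℚ * (a * (a + 1ℚ + 1ℚ))                             ≤⟨ 0≤p-q⇒q≤p (subst (0ℚ ≤_) (arith₃ a) (<⇒≤ 0<1)) ⟩
    1ℚ * ((a + 1ℚ) * (a + 1ℚ))                           ∎)
    where
    open ≤-Reasoning
    a = fromℕ (suc (2 ℕ.* k))
    c = central k
    c′ = central (suc k)
    0≤a = 0≤fromℕ (suc (2 ℕ.* k))
    0<a+1 = +-mono-≤-< 0≤a 0<1
    0≤a[a+2] = *-nonNeg 0≤a (+-mono-≤ (<⇒≤ 0<a+1) (<⇒≤ 0<1))
    arith₁ : ∀ a c → c * c * (a + 1ℚ + 1ℚ) * ((a + 1ℚ) * (a + 1ℚ)) ≡ (c * (a + 1ℚ)) * (c * (a + 1ℚ)) * (a + 1ℚ + 1ℚ)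
    arith₁ = solve-∀ ℚ-ring
    arith₂ : ∀ a c → (c * a) * (c * a) * (a + 1ℚ + 1ℚ) ≡ c * c * a * (a * (a + 1ℚ + 1ℚ))
    arith₂ = solve-∀ ℚ-ring
    arith₃ : ∀ a → 1ℚ ≡ 1ℚ * ((a + 1ℚ) * (a + 1ℚ)) - 1ℚ * (a * (a + 1ℚ + 1ℚ))
    arith₃ = solve-∀ ℚ-ring

  -- With `s = M + 1`, one step multiplies the first factor by `4s² / (4s² - 1)` and the second by
  -- the reciprocal, so the product keeps its value at `M = 0`.
  weightedLeibniz-central : ∀ M →
    weightedLeibniz M * (central M * central M * fromℕ (suc (2 ℕ.* M))) ≡ 4ℚ
  weightedLeibniz-central zero    = refl
  weightedLeibniz-central (suc M) = *-cancelʳ-≡ ((a + 1ℚ) * (a + 1ℚ)) (*-pos 0<a+1 0<a+1) (begin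
    T′ * (c′ * c′ * fromℕ (suc (2 ℕ.* suc M))) * ((a + 1ℚ) * (a + 1ℚ))
      ≡⟨ cong (λ t → T′ * (c′ * c′ * t) * ((a + 1ℚ) * (a + 1ℚ))) (fromℕ-1+2*suc M) ⟩
    T′ * (c′ * c′ * (a + 1ℚ + 1ℚ)) * ((a + 1ℚ) * (a + 1ℚ))    ≡⟨ arith₁ a c′ T′ ⟩
    T′ * ((c′ * (a + 1ℚ)) * (c′ * (a + 1ℚ)) * (a + 1ℚ + 1ℚ))
      ≡⟨ cong (λ t → T′ * (t * t * (a + 1ℚ + 1ℚ))) (central-suc-cleared M) ⟩
    T′ * ((c * a) * (c * a) * (a + 1ℚ + 1ℚ))                  ≡⟨ arith₂ a c T′ ⟩
    c * c * a * (((a + 1ℚ) * (a + 1ℚ) - 1ℚ) * T′)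
      ≡⟨ cong (λ t → c * c * a * ((t * t - 1ℚ) * T′)) a+1≡2s ⟩
    c * c * a * (((s + s) * (s + s) - 1ℚ) * T′)               ≡⟨ cong (c * c * a *_) (arith₃ s T′) ⟩
    c * c * a * ((4ℚ * (s * s) - 1ℚ) * T′)                    ≡⟨ cong (c * c * a *_) (weightedLeibniz-suc M) ⟨
    c * c * a * (4ℚ * (s * s) * T)                            ≡⟨ arith₄ s (c * c * a) T ⟩
    T * (c * c * a) * ((s + s) * (s + s))                     ≡⟨ cong (_* ((s + s) * (s + s))) (weightedLeibniz-central M) ⟩
    4ℚ * ((s + s) * (s + s))                                  ≡⟨ cong (λ t → 4ℚ * (t * t)) a+1≡2s ⟨
    4ℚ * ((a + 1ℚ) * (a + 1ℚ))                                ∎)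
    where
    open ≡-Reasoning
    a = fromℕ (suc (2 ℕ.* M))
    s = fromℕ (suc M)
    c = central M
    c′ = central (suc M)
    T = weightedLeibniz M
    T′ = weightedLeibniz (suc M)
    0<a+1 = +-mono-≤-< (0≤fromℕ (suc (2 ℕ.* M))) 0<1
    a+1≡2s : a + 1ℚ ≡ s + s
    a+1≡2s = trans (cong (_+ 1ℚ) (fromℕ-1+2* M)) (trans (arith (fromℕ M))
      (cong₂ _+_ (sym (fromℕ-suc M)) (sym (fromℕ-suc M))))
      where
      arith : ∀ m → 1ℚ + (m + m) + 1ℚ ≡ m + 1ℚ + (m + 1ℚ)
      arith = solve-∀ ℚ-ring
    arith₁ : ∀ a c T → T * (c * c * (a + 1ℚ + 1ℚ)) * ((a + 1ℚ) * (a + 1ℚ))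
      ≡ T * ((c * (a + 1ℚ)) * (c * (a + 1ℚ)) * (a + 1ℚ + 1ℚ))
    arith₁ = solve-∀ ℚ-ring
    arith₂ : ∀ a c T → T * ((c * a) * (c * a) * (a + 1ℚ + 1ℚ)) ≡ c * c * a * (((a + 1ℚ) * (a + 1ℚ) - 1ℚ) * T)
    arith₂ = solve-∀ ℚ-ring
    arith₃ : ∀ s T → ((s + s) * (s + s) - 1ℚ) * T ≡ (4ℚ * (s * s) - 1ℚ) * T
    arith₃ = solve-∀ ℚ-ring
    arith₄ : ∀ s x T → x * (4ℚ * (s * s) * T) ≡ T * x * ((s + s) * (s + s))
    arith₄ = solve-∀ ℚ-ring

  -- Limits

  ≤-/ : ∀ {p} a k → p * fromℕ (suc k) ≤ fromℕ a → p ≤ + a / suc k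
  ≤-/ a k h = *-cancelʳ-≤ (fromℕ (suc k)) (0<fromℕ-suc k) (≤-trans h (≤-reflexive (sym (/-*-cancel a k))))

  fromℕ-*-/ : ∀ a b k → fromℕ a * (+ b / suc k) ≡ + (a ℕ.* b) / suc k
  fromℕ-*-/ a b k = *-cancelʳ-≡ (fromℕ (suc k)) (0<fromℕ-suc k) (begin
    fromℕ a * (+ b / suc k) * fromℕ (suc k)    ≡⟨ *-assoc (fromℕ a) (+ b / suc k) (fromℕ (suc k)) ⟩
    fromℕ a * ((+ b / suc k) * fromℕ (suc k))  ≡⟨ cong (fromℕ a *_) (/-*-cancel b k) ⟩
    fromℕ a * fromℕ b                          ≡⟨ fromℕ-* a b ⟨
    fromℕ (a ℕ.* b)                            ≡⟨ /-*-cancel (a ℕ.* b) k ⟨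
    + (a ℕ.* b) / suc k * fromℕ (suc k)        ∎)
    where open ≡-Reasoning

  2ℚ : ℚ
  2ℚ = 1ℚ + 1ℚ

  0≤2 : 0ℚ ≤ 2ℚ
  0≤2 = nonNegative⁻¹ 2ℚ

  twiceAbsTerm : ℕ → ℚ
  twiceAbsTerm i = 2ℚ * absTerm i

  twiceAbsTerm-antitone : ∀ i → twiceAbsTerm (suc i) ≤ twiceAbsTerm i
  twiceAbsTerm-antitone i = *-monoʳ-≤ 0≤2 (absTerm-antimono (ℕ.n≤1+n i))

  0≤absTerm : ∀ i → 0ℚ ≤ absTerm i
  0≤absTerm i = 0≤-/ 4 (2 ℕ.* i)

  0≤twiceAbsTerm : ∀ i → 0ℚ ≤ twiceAbsTerm i
  0≤twiceAbsTerm i = *-nonNeg 0≤2 (0≤absTerm i)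

  0≤weightedTerm : ∀ M i → 0ℚ ≤ weightedTerm M i
  0≤weightedTerm M i = *-nonNeg (+-mono-≤ (0≤weight M i) (0≤weight M (suc i))) (0≤absTerm i)

  weightedTerm-antitone : ∀ M i → weightedTerm M (suc i) ≤ weightedTerm M i
  weightedTerm-antitone M i = *-mono-≤ (+-mono-≤ (0≤weight M (suc i)) (0≤weight M (suc (suc i)))) (0≤absTerm i)
    (+-mono-≤ (weight-antitone M i) (weight-antitone M (suc i))) (absTerm-antimono (ℕ.n≤1+n i))

  weightedTerm≤ : ∀ M i → weightedTerm M i ≤ twiceAbsTerm i
  weightedTerm≤ M i = *-monoˡ-≤ (0≤absTerm i) (+-mono-≤ (weight≤1 M i) (weight≤1 M (suc i)))

  -- The 8 arises from two weights, each off by at most `K² / (M + 1)`, and from `absTerm i ≤ 4`.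
  -- The strict `i < K` lets the bound cover the weight at `i + 1` too.
  weightedTerm-close : ∀ M K i → i ℕ.< K →
    ∣ weightedTerm M i - twiceAbsTerm i ∣ ≤ + (8 ℕ.* (K ℕ.* K)) / suc M
  weightedTerm-close M K i i<K = ≤-/ (8 ℕ.* (K ℕ.* K)) M (begin
    ∣ weightedTerm M i - twiceAbsTerm i ∣ * s
      ≡⟨ cong (_* s) (trans (swap-∣-∣ (weightedTerm M i) (twiceAbsTerm i)) (0≤p⇒∣p∣≡p (0≤-sub (weightedTerm≤ M i)))) ⟩
    (2ℚ * absTerm i - (u + u′) * absTerm i) * s      ≡⟨ arith₁ (absTerm i) u u′ s ⟩
    ((1ℚ - u) * s + (1ℚ - u′) * s) * absTerm i
      ≤⟨ *-mono-≤ 0≤gap (<⇒≤ 0<4) (+-mono-≤ (gap i (ℕ.<⇒≤ i<K)) (gap (suc i) i<K)) (absTerm-antimono (z≤n {i})) ⟩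
    (fromℕ K * fromℕ K + fromℕ K * fromℕ K) * 4ℚ     ≡⟨ arith₂ (fromℕ K * fromℕ K) ⟩
    fromℕ 8 * (fromℕ K * fromℕ K)                    ≡⟨ cong (fromℕ 8 *_) (fromℕ-* K K) ⟨
    fromℕ 8 * fromℕ (K ℕ.* K)                        ≡⟨ fromℕ-* 8 (K ℕ.* K) ⟨
    fromℕ (8 ℕ.* (K ℕ.* K))                          ∎)
    where
    open ≤-Reasoning
    s = fromℕ (suc M)
    u = weight M i
    u′ = weight M (suc i)
    0≤gap : 0ℚ ≤ (1ℚ - u) * s + (1ℚ - u′) * s
    0≤gap = +-mono-≤ (*-nonNeg (0≤-sub (weight≤1 M i)) (0≤fromℕ (suc M)))
                     (*-nonNeg (0≤-sub (weight≤1 M (suc i))) (0≤fromℕ (suc M)))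
    gap : ∀ j → j ℕ.≤ K → (1ℚ - weight M j) * s ≤ fromℕ K * fromℕ K
    gap j j≤K = ≤-trans (1-weight-bound M j)
      (*-mono-≤ (0≤fromℕ j) (0≤fromℕ K) (fromℕ-mono-≤ j≤K) (fromℕ-mono-≤ j≤K))
    arith₁ : ∀ o u u′ s → (2ℚ * o - (u + u′) * o) * s ≡ ((1ℚ - u) * s + (1ℚ - u′) * s) * o
    arith₁ = solve-∀ ℚ-ring
    arith₂ : ∀ k → (k + k) * 4ℚ ≡ (4ℚ + 4ℚ) * k
    arith₂ = solve-∀ ℚ-ring

  alternating-* : ∀ p b m → alternating (λ i → p * b i) m ≡ p * alternating b m
  alternating-* p b zero    = sym (*-zeroʳ p)
  alternating-* p b (suc m) = trans (cong (λ t → p * b 0 - t) (alternating-* p (b ∘ suc) m))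
    (arith p (b 0) (alternating (b ∘ suc) m))
    where
    arith : ∀ p x y → p * x - p * y ≡ p * (x - y)
    arith = solve-∀ ℚ-ring

  -- Both alternating sums are cut at a common K, chosen first, where their tails are small;
  -- the heads then agree termwise as M → ∞.
  weightedLeibniz-limit : ∀ {ε} → 0ℚ < ε → ∃[ N ] (∀ M m → N ℕ.≤ M → N ℕ.≤ m →
    ∣ weightedLeibniz M - 2ℚ * leibnizSum m ∣ ≤ ε)
  weightedLeibniz-limit {ε} 0<ε = N , bound
    where
    η : ℚ
    η = ε * (+ 1 / 3)
    0<η : 0ℚ < η
    0<η = *-pos 0<ε (positive⁻¹ (+ 1 / 3))
    -- The first omitted term of the doubled Leibniz series is `8 / (2K + 1)`.
    K = proj₁ (archimedean 8 0<η)
    e : ℕ → ℚ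
    e M = + (8 ℕ.* (K ℕ.* K)) / suc M
    -- The heads have `K` terms, each with error at most `e M`. Taking `N` at least `K` keeps the
    -- cut inside both sums.
    L = proj₁ (archimedean (K ℕ.* (8 ℕ.* (K ℕ.* K))) 0<η)
    N = K ℕ.⊔ L

    tail≤η : twiceAbsTerm K ≤ η
    tail≤η = begin
      2ℚ * (+ 4 / suc (2 ℕ.* K))       ≡⟨ fromℕ-*-/ 2 4 (2 ℕ.* K) ⟩
      + 8 / suc (2 ℕ.* K)              <⟨ proj₂ (archimedean 8 0<η) (ℕ.m≤m+n K (K ℕ.+ 0)) ⟩
      η                                ∎
      where open ≤-Reasoning

    bound : ∀ M m → N ℕ.≤ M → N ℕ.≤ m → ∣ weightedLeibniz M - 2ℚ * leibnizSum m ∣ ≤ ε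
    bound M m N≤M N≤m = begin
      ∣ x - 2ℚ * leibnizSum m ∣          ≡⟨ cong (λ t → ∣ x - t ∣) (trans (cong (2ℚ *_) (leibnizSum≡alternating m))
                                              (sym (alternating-* 2ℚ absTerm m))) ⟩
      ∣ x - y ∣                          ≡⟨ cong ∣_∣ (arith x x₀ y₀ y) ⟩
      ∣ (x - x₀) + (x₀ - y₀) + (y₀ - y) ∣
        ≤⟨ ∣p+q∣≤∣p∣+∣q∣ ((x - x₀) + (x₀ - y₀)) (y₀ - y) ⟩
      ∣ (x - x₀) + (x₀ - y₀) ∣ + ∣ y₀ - y ∣
        ≤⟨ +-monoˡ-≤ ∣ y₀ - y ∣ (∣p+q∣≤∣p∣+∣q∣ (x - x₀) (x₀ - y₀)) ⟩
      ∣ x - x₀ ∣ + ∣ x₀ - y₀ ∣ + ∣ y₀ - y ∣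
        ≤⟨ +-mono-≤ (+-mono-≤ tailˣ head) tailʸ ⟩
      η + η + η                          ≡⟨ thirds ε ⟩
      ε                                  ∎
      where
      open ≤-Reasoning
      K≤M = ℕ.m⊔n≤o⇒m≤o K L N≤M
      K≤m = ℕ.m⊔n≤o⇒m≤o K L N≤m
      x  = weightedLeibniz M
      x₀ = alternating (weightedTerm M) K
      y₀ = alternating twiceAbsTerm K
      y  = alternating twiceAbsTerm m
      tailˣ : ∣ x - x₀ ∣ ≤ η
      tailˣ = ≤-trans (subst (λ j → ∣ alternating (weightedTerm M) j - x₀ ∣ ≤ weightedTerm M K)
          (ℕ.m+[n∸m]≡n (ℕ.m≤n⇒m≤1+n K≤M))
          (alternating-tail (0≤weightedTerm M) (weightedTerm-antitone M) K (suc M ℕ.∸ K)))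
        (≤-trans (weightedTerm≤ M K) tail≤η)
      tailʸ : ∣ y₀ - y ∣ ≤ η
      tailʸ = ≤-trans (subst (λ j → ∣ y₀ - alternating twiceAbsTerm j ∣ ≤ twiceAbsTerm K) (ℕ.m+[n∸m]≡n K≤m)
          (subst (_≤ twiceAbsTerm K) (swap-∣-∣ (alternating twiceAbsTerm (K ℕ.+ (m ℕ.∸ K))) y₀)
            (alternating-tail 0≤twiceAbsTerm twiceAbsTerm-antitone K (m ℕ.∸ K))))
        tail≤η
      head : ∣ x₀ - y₀ ∣ ≤ η
      head = begin
        ∣ x₀ - y₀ ∣        ≤⟨ alternating-close K (weightedTerm-close M K) ⟩
        fromℕ K * e M      ≡⟨ fromℕ-*-/ K (8 ℕ.* (K ℕ.* K)) M ⟩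
        + (K ℕ.* (8 ℕ.* (K ℕ.* K))) / suc M
          <⟨ proj₂ (archimedean (K ℕ.* (8 ℕ.* (K ℕ.* K))) 0<η) (ℕ.m⊔n≤o⇒n≤o K L N≤M) ⟩
        η                  ∎
      arith : ∀ x x₀ y₀ y → x - y ≡ (x - x₀) + (x₀ - y₀) + (y₀ - y)
      arith = solve-∀ ℚ-ring
      thirds : ∀ p → p * (+ 1 / 3) + p * (+ 1 / 3) + p * (+ 1 / 3) ≡ p
      thirds = solve-∀ ℚ-ring

  -- A joint limit: `k` governs the size of the tree and `m` the precision of π. The threshold for
  -- `k` must not depend on `m`, nor that for `m` on `k`.
  TendsTo1 : (ℕ → ℕ → ℚ) → Set
  TendsTo1 x = ∀ {ε} → 0ℚ < ε → ∃[ N ] (∀ k m → N ℕ.≤ k → N ℕ.≤ m → ∣ x k m - 1ℚ ∣ ≤ ε)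

  TendsTo1-* : ∀ {x y} → TendsTo1 x → TendsTo1 y → TendsTo1 (λ k m → x k m * y k m)
  TendsTo1-* {x} {y} x→1 y→1 {ε} 0<ε =
    -- The crude bound by 1 serves only the product of the two deviations.
    let L  , x≤1 = x→1 0<1
        L′ , x≤η = x→1 0<η
        L″ , y≤η = y→1 0<η
    in L ℕ.⊔ (L′ ℕ.⊔ L″) , λ k m k≥ m≥ →
      let k≥′ = ℕ.m⊔n≤o⇒n≤o L (L′ ℕ.⊔ L″) k≥
          m≥′ = ℕ.m⊔n≤o⇒n≤o L (L′ ℕ.⊔ L″) m≥
      in bound (x k m) (y k m)
        (x≤1 k m (ℕ.m⊔n≤o⇒m≤o L (L′ ℕ.⊔ L″) k≥) (ℕ.m⊔n≤o⇒m≤o L (L′ ℕ.⊔ L″) m≥))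
        (x≤η k m (ℕ.m⊔n≤o⇒m≤o L′ L″ k≥′) (ℕ.m⊔n≤o⇒m≤o L′ L″ m≥′))
        (y≤η k m (ℕ.m⊔n≤o⇒n≤o L′ L″ k≥′) (ℕ.m⊔n≤o⇒n≤o L′ L″ m≥′))
    where
    η : ℚ
    η = ε * (+ 1 / 3)
    0<η : 0ℚ < η
    0<η = *-pos 0<ε (positive⁻¹ (+ 1 / 3))
    bound : ∀ p q → ∣ p - 1ℚ ∣ ≤ 1ℚ → ∣ p - 1ℚ ∣ ≤ η → ∣ q - 1ℚ ∣ ≤ η → ∣ p * q - 1ℚ ∣ ≤ ε
    bound p q p≤1 p≤η q≤η = begin
      ∣ p * q - 1ℚ ∣                                             ≡⟨ cong ∣_∣ (arith p q) ⟩
      ∣ (p - 1ℚ) * (q - 1ℚ) + (p - 1ℚ) + (q - 1ℚ) ∣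
        ≤⟨ ∣p+q∣≤∣p∣+∣q∣ ((p - 1ℚ) * (q - 1ℚ) + (p - 1ℚ)) (q - 1ℚ) ⟩
      ∣ (p - 1ℚ) * (q - 1ℚ) + (p - 1ℚ) ∣ + ∣ q - 1ℚ ∣
        ≤⟨ +-monoˡ-≤ ∣ q - 1ℚ ∣ (∣p+q∣≤∣p∣+∣q∣ ((p - 1ℚ) * (q - 1ℚ)) (p - 1ℚ)) ⟩
      ∣ (p - 1ℚ) * (q - 1ℚ) ∣ + ∣ p - 1ℚ ∣ + ∣ q - 1ℚ ∣
        ≡⟨ cong (λ t → t + ∣ p - 1ℚ ∣ + ∣ q - 1ℚ ∣) (∣p*q∣≡∣p∣*∣q∣ (p - 1ℚ) (q - 1ℚ)) ⟩
      ∣ p - 1ℚ ∣ * ∣ q - 1ℚ ∣ + ∣ p - 1ℚ ∣ + ∣ q - 1ℚ ∣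
        ≤⟨ +-mono-≤ (+-mono-≤ (*-mono-≤ (0≤∣p∣ (p - 1ℚ)) (<⇒≤ 0<η) p≤1 q≤η) p≤η) q≤η ⟩
      1ℚ * η + η + η                                             ≡⟨ thirds ε ⟩
      ε                                                          ∎
      where
      open ≤-Reasoning
      arith : ∀ p q → p * q - 1ℚ ≡ (p - 1ℚ) * (q - 1ℚ) + (p - 1ℚ) + (q - 1ℚ)
      arith = solve-∀ ℚ-ring
      thirds : ∀ p → 1ℚ * (p * (+ 1 / 3)) + p * (+ 1 / 3) + p * (+ 1 / 3) ≡ p
      thirds = solve-∀ ℚ-ring

  -- `weightedLeibniz k` tends to 2π and its product with the Wallis factor is 4, so the latter
  -- tends to 2/π. Multiplying the error of `weightedLeibniz k` by the Wallis factor, which is at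
  -- most 1, avoids any division.
  wallis : TendsTo1 (λ k m → ½ * leibnizSum m * (central k * central k * fromℕ (suc (2 ℕ.* k))))
  wallis {ε} 0<ε = let N , close = weightedLeibniz-limit 0<ε
    in N , λ k m N≤k N≤m → bound (weightedLeibniz k) (leibnizSum m) (central k * central k * fromℕ (suc (2 ℕ.* k)))
         (*-nonNeg (<⇒≤ (*-pos (0<central k) (0<central k))) (0≤fromℕ (suc (2 ℕ.* k))))
         (central²-bound k) (weightedLeibniz-central k) (close k m N≤k N≤m)
    where
    ¼ : ℚ
    ¼ = + 1 / 4
    bound : ∀ T p y → 0ℚ ≤ y → y ≤ 1ℚ → T * y ≡ 4ℚ → ∣ T - 2ℚ * p ∣ ≤ ε → ∣ ½ * p * y - 1ℚ ∣ ≤ ε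
    bound T p y 0≤y y≤1 Ty≡4 close = begin
      ∣ ½ * p * y - 1ℚ ∣             ≡⟨ cong ∣_∣ (trans (arith T p y) (cong (λ t → - (¼ * ((T - 2ℚ * p) * y)) + ¼ * (t - 4ℚ)) Ty≡4)) ⟩
      ∣ - (¼ * ((T - 2ℚ * p) * y)) + 0ℚ ∣ ≡⟨ cong ∣_∣ (+-identityʳ (- (¼ * ((T - 2ℚ * p) * y)))) ⟩
      ∣ - (¼ * ((T - 2ℚ * p) * y)) ∣ ≡⟨ ∣-p∣≡∣p∣ (¼ * ((T - 2ℚ * p) * y)) ⟩
      ∣ ¼ * ((T - 2ℚ * p) * y) ∣     ≡⟨ ∣p*q∣≡∣p∣*∣q∣ ¼ ((T - 2ℚ * p) * y) ⟩
      ¼ * ∣ (T - 2ℚ * p) * y ∣       ≡⟨ cong (¼ *_) (∣p*q∣≡∣p∣*∣q∣ (T - 2ℚ * p) y) ⟩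
      ¼ * (∣ T - 2ℚ * p ∣ * ∣ y ∣)   ≡⟨ cong (λ t → ¼ * (∣ T - 2ℚ * p ∣ * t)) (0≤p⇒∣p∣≡p 0≤y) ⟩
      ¼ * (∣ T - 2ℚ * p ∣ * y)       ≤⟨ *-mono-≤ (nonNegative⁻¹ ¼) (*-nonNeg (<⇒≤ 0<ε) (<⇒≤ 0<1))
                                          (≤ᵇ⇒≤ {¼} {1ℚ} _) (*-mono-≤ (0≤∣p∣ (T - 2ℚ * p)) (<⇒≤ 0<1) close y≤1) ⟩
      1ℚ * (ε * 1ℚ)                  ≡⟨ trans (*-identityˡ (ε * 1ℚ)) (*-identityʳ ε) ⟩
      ε                              ∎
      where
      open ≤-Reasoning
      arith : ∀ T p y → ½ * p * y - 1ℚ ≡ - (¼ * ((T - 2ℚ * p) * y)) + ¼ * (T * y - 4ℚ)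
      arith = solve-∀ ℚ-ring

  ratio : ℕ → ℕ → ℕ → ℚ
  ratio a b k = + suc (2 ℕ.* k ℕ.+ a) / suc (2 ℕ.* k ℕ.+ b)

  ratio-cancel : ∀ a b k → ratio a b k * fromℕ (suc (2 ℕ.* k ℕ.+ b)) ≡ fromℕ (suc (2 ℕ.* k ℕ.+ a))
  ratio-cancel a b k = /-*-cancel (suc (2 ℕ.* k ℕ.+ a)) (2 ℕ.* k ℕ.+ b)

  ratio→1 : ∀ a b → TendsTo1 (λ k _ → ratio a b k)
  ratio→1 a b 0<ε = let N , small = archimedean (a ℕ.+ b) 0<ε
    in N , λ k _ N≤k _ → ≤-trans (≤-/ (a ℕ.+ b) (2 ℕ.* k ℕ.+ b) (close k))
         (<⇒≤ (small (ℕ.≤-trans N≤k (ℕ.≤-trans (ℕ.m≤m+n k (k ℕ.+ 0)) (ℕ.m≤m+n (2 ℕ.* k) b)))))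
    where
    open ≤-Reasoning
    close : ∀ k → ∣ ratio a b k - 1ℚ ∣ * fromℕ (suc (2 ℕ.* k ℕ.+ b)) ≤ fromℕ (a ℕ.+ b)
    close k = begin
      ∣ r - 1ℚ ∣ * B            ≡⟨ cong (∣ r - 1ℚ ∣ *_) (0≤p⇒∣p∣≡p (0≤fromℕ (suc (2 ℕ.* k ℕ.+ b)))) ⟨
      ∣ r - 1ℚ ∣ * ∣ B ∣        ≡⟨ ∣p*q∣≡∣p∣*∣q∣ (r - 1ℚ) B ⟨
      ∣ (r - 1ℚ) * B ∣          ≡⟨ cong ∣_∣ (arith₁ r B) ⟩
      ∣ r * B - B ∣             ≡⟨ cong ∣_∣ (cong₂ _-_ (trans (ratio-cancel a b k) (fromℕ-suc-+ (2 ℕ.* k) a)) (fromℕ-suc-+ (2 ℕ.* k) b)) ⟩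
      ∣ (fromℕ (2 ℕ.* k) + fromℕ a + 1ℚ) - (fromℕ (2 ℕ.* k) + fromℕ b + 1ℚ) ∣
                                ≡⟨ cong ∣_∣ (arith₂ (fromℕ (2 ℕ.* k)) (fromℕ a) (fromℕ b)) ⟩
      ∣ fromℕ a - fromℕ b ∣     ≤⟨ ∣p-q∣≤∣p∣+∣q∣ (fromℕ a) (fromℕ b) ⟩
      ∣ fromℕ a ∣ + ∣ fromℕ b ∣ ≡⟨ cong₂ (λ s t → s + t) (0≤p⇒∣p∣≡p {fromℕ a} (0≤fromℕ a)) (0≤p⇒∣p∣≡p {fromℕ b} (0≤fromℕ b)) ⟩
      fromℕ a + fromℕ b         ≡⟨ fromℕ-+ a b ⟨
      fromℕ (a ℕ.+ b)           ∎
      where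
      r = ratio a b k
      B = fromℕ (suc (2 ℕ.* k ℕ.+ b))
      arith₁ : ∀ r B → (r - 1ℚ) * B ≡ r * B - B
      arith₁ = solve-∀ ℚ-ring
      arith₂ : ∀ k a b → (k + a + 1ℚ) - (k + b + 1ℚ) ≡ a - b
      arith₂ = solve-∀ ℚ-ring

  -- (2k + 1)(2k + 2) ⋯ (2k + j) / (2k + q + 1)^j
  risingRatio : ℕ → ℕ → ℕ → ℚ
  risingRatio q zero    k = 1ℚ
  risingRatio q (suc j) k = risingRatio q j k * ratio j q k

  risingRatio→1 : ∀ q j → TendsTo1 (λ k _ → risingRatio q j k)
  risingRatio→1 q zero    0<ε = 0 , λ _ _ _ _ → <⇒≤ 0<ε
  risingRatio→1 q (suc j) = TendsTo1-* {λ k _ → risingRatio q j k} {λ k _ → ratio j q k} (risingRatio→1 q j) (ratio→1 j q)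

  -- The count in terms of convergent factors

  0<fromℕ : ∀ n .{{_ : ℕ.NonZero n}} → 0ℚ < fromℕ n
  0<fromℕ (suc n) = 0<fromℕ-suc n

  fromℕ-suc-! : ∀ n → fromℕ (suc n ℕ.!) ≡ fromℕ (suc n) * fromℕ (n ℕ.!)
  fromℕ-suc-! n = fromℕ-* (suc n) (n ℕ.!)

  0<fromℕ-! : ∀ n → 0ℚ < fromℕ (n ℕ.!)
  0<fromℕ-! n = 0<fromℕ (n ℕ.!) {{ℕ._!≢0 n}}

  central-! : ∀ k →
    central k * fromℕ (4 ℕ.^ k) * (fromℕ (k ℕ.!) * fromℕ (k ℕ.!)) ≡ fromℕ ((2 ℕ.* k) ℕ.!)
  central-! zero    = refl
  central-! (suc k) = begin
    c′ * fromℕ (4 ℕ.^ suc k) * (fromℕ (suc k ℕ.!) * fromℕ (suc k ℕ.!))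
      ≡⟨ cong₂ (λ t u → c′ * t * (u * u)) (fromℕ-* 4 (4 ℕ.^ k)) (trans (fromℕ-suc-! k) (cong (_* f) (fromℕ-suc k))) ⟩
    c′ * (4ℚ * P) * ((K + 1ℚ) * f * ((K + 1ℚ) * f))
      ≡⟨ arith₁ c′ P K f ⟩
    c′ * (1ℚ + (K + K) + 1ℚ) * (P * (f * f)) * (1ℚ + (K + K) + 1ℚ)
      ≡⟨ cong (λ t → c′ * (t + 1ℚ) * (P * (f * f)) * (t + 1ℚ)) (fromℕ-1+2* k) ⟨
    c′ * (a + 1ℚ) * (P * (f * f)) * (a + 1ℚ)
      ≡⟨ cong (λ t → t * (P * (f * f)) * (a + 1ℚ)) (central-suc-cleared k) ⟩
    c * a * (P * (f * f)) * (a + 1ℚ)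
      ≡⟨ arith₂ c a P f ⟩
    (a + 1ℚ) * (a * (c * P * (f * f)))
      ≡⟨ cong₂ (λ t u → t * (a * u)) (sym (fromℕ-suc (suc (2 ℕ.* k)))) (central-! k) ⟩
    fromℕ (suc (suc (2 ℕ.* k))) * (a * fromℕ ((2 ℕ.* k) ℕ.!))
      ≡⟨ cong (fromℕ (suc (suc (2 ℕ.* k))) *_) (fromℕ-suc-! (2 ℕ.* k)) ⟨
    fromℕ (suc (suc (2 ℕ.* k))) * fromℕ (suc (2 ℕ.* k) ℕ.!)
      ≡⟨ fromℕ-suc-! (suc (2 ℕ.* k)) ⟨
    fromℕ (suc (suc (2 ℕ.* k)) ℕ.!)
      ≡⟨ cong (λ j → fromℕ (j ℕ.!)) (ℕ.*-suc 2 k) ⟨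
    fromℕ ((2 ℕ.* suc k) ℕ.!) ∎
    where
    open ≡-Reasoning
    c = central k
    c′ = central (suc k)
    a = fromℕ (suc (2 ℕ.* k))
    P = fromℕ (4 ℕ.^ k)
    K = fromℕ k
    f = fromℕ (k ℕ.!)
    arith₁ : ∀ c P K f → c * (4ℚ * P) * ((K + 1ℚ) * f * ((K + 1ℚ) * f))
      ≡ c * (1ℚ + (K + K) + 1ℚ) * (P * (f * f)) * (1ℚ + (K + K) + 1ℚ)
    arith₁ = solve-∀ ℚ-ring
    arith₂ : ∀ c a P f → c * a * (P * (f * f)) * (a + 1ℚ) ≡ (a + 1ℚ) * (a * (c * P * (f * f)))
    arith₂ = solve-∀ ℚ-ring

  risingRatio-! : ∀ q j k →
    risingRatio q j k * fromℕ (suc (2 ℕ.* k ℕ.+ q)) ^ j * fromℕ ((2 ℕ.* k) ℕ.!) ≡ fromℕ ((2 ℕ.* k ℕ.+ j) ℕ.!)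
  risingRatio-! q zero    k = trans (*-identityˡ (fromℕ ((2 ℕ.* k) ℕ.!)))
    (cong (λ m → fromℕ (m ℕ.!)) (sym (ℕ.+-identityʳ (2 ℕ.* k))))
  risingRatio-! q (suc j) k = begin
    R * ratio j q k * (N * N ^ j) * F          ≡⟨ arith R (ratio j q k) N (N ^ j) F ⟩
    ratio j q k * N * (R * N ^ j * F)          ≡⟨ cong₂ _*_ (ratio-cancel j q k) (risingRatio-! q j k) ⟩
    fromℕ (suc (2 ℕ.* k ℕ.+ j)) * fromℕ ((2 ℕ.* k ℕ.+ j) ℕ.!)
                                               ≡⟨ fromℕ-suc-! (2 ℕ.* k ℕ.+ j) ⟨
    fromℕ (suc (2 ℕ.* k ℕ.+ j) ℕ.!)            ≡⟨ cong (λ m → fromℕ (m ℕ.!)) (ℕ.+-suc (2 ℕ.* k) j) ⟨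
    fromℕ ((2 ℕ.* k ℕ.+ suc j) ℕ.!)            ∎
    where
    open ≡-Reasoning
    R = risingRatio q j k
    N = fromℕ (suc (2 ℕ.* k ℕ.+ q))
    F = fromℕ ((2 ℕ.* k) ℕ.!)
    arith : ∀ R r N M F → R * r * (N * M) * F ≡ r * N * (R * M * F)
    arith = solve-∀ ℚ-ring

  -- The rational part of the claimed equivalent; its other two factors are square roots.
  scale : ℕ → ℕ → ℚ
  scale q n = fromℕ (2 ℕ.^ q ℕ.* q ℕ.!) ⁻¹ * fromℕ (2 ℕ.^ n)

  0<2^ : ∀ n → 0ℚ < fromℕ (2 ℕ.^ n)
  0<2^ n = 0<fromℕ (2 ℕ.^ n) {{ℕ.m^n≢0 2 n}}

  0<2^*! : ∀ q → 0ℚ < fromℕ (2 ℕ.^ q ℕ.* q ℕ.!)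
  0<2^*! q = subst (0ℚ <_) (sym (fromℕ-* (2 ℕ.^ q) (q ℕ.!))) (*-pos (0<2^ q) (0<fromℕ-! q))

  0<scale : ∀ q n → 0ℚ < scale q n
  0<scale q n = *-pos (⁻¹-pos (0<2^*! q)) (0<2^ n)

  2^1+2k+q : ∀ k q → 2 ℕ.^ suc (2 ℕ.* k ℕ.+ q) ≡ 2 ℕ.* 4 ℕ.^ k ℕ.* 2 ℕ.^ q
  2^1+2k+q k q = trans (cong (2 ℕ.*_) (trans (ℕ.^-distribˡ-+-* 2 (2 ℕ.* k) q)
    (cong (ℕ._* 2 ℕ.^ q) (sym (ℕ.^-*-assoc 2 2 k))))) (sym (ℕ.*-assoc 2 (4 ℕ.^ k) (2 ℕ.^ q)))

  scale-! : ∀ k q → scale q (suc (2 ℕ.* k ℕ.+ q)) * fromℕ (q ℕ.!) ≡ 2ℚ * fromℕ (4 ℕ.^ k)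
  scale-! k q = *-cancelʳ-≡ (fromℕ (2 ℕ.^ q)) (0<2^ q) (begin
    D ⁻¹ * E * fromℕ (q ℕ.!) * fromℕ (2 ℕ.^ q)    ≡⟨ arith (D ⁻¹) E (fromℕ (q ℕ.!)) (fromℕ (2 ℕ.^ q)) ⟩
    fromℕ (2 ℕ.^ q) * fromℕ (q ℕ.!) * D ⁻¹ * E    ≡⟨ cong (λ t → t * D ⁻¹ * E) (fromℕ-* (2 ℕ.^ q) (q ℕ.!)) ⟨
    D * D ⁻¹ * E                                  ≡⟨ cong (_* E) (⁻¹-inverseʳ (0<2^*! q)) ⟩
    1ℚ * E                                        ≡⟨ *-identityˡ E ⟩
    E                                             ≡⟨ cong fromℕ (2^1+2k+q k q) ⟩
    fromℕ (2 ℕ.* 4 ℕ.^ k ℕ.* 2 ℕ.^ q)             ≡⟨ fromℕ-* (2 ℕ.* 4 ℕ.^ k) (2 ℕ.^ q) ⟩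
    fromℕ (2 ℕ.* 4 ℕ.^ k) * fromℕ (2 ℕ.^ q)       ≡⟨ cong (_* fromℕ (2 ℕ.^ q)) (fromℕ-* 2 (4 ℕ.^ k)) ⟩
    2ℚ * fromℕ (4 ℕ.^ k) * fromℕ (2 ℕ.^ q)        ∎)
    where
    open ≡-Reasoning
    D = fromℕ (2 ℕ.^ q ℕ.* q ℕ.!)
    E = fromℕ (2 ℕ.^ suc (2 ℕ.* k ℕ.+ q))
    arith : ∀ d e f g → d * e * f * g ≡ g * f * d * e
    arith = solve-∀ ℚ-ring

  ^-+ : ∀ p m n → p ^ (m ℕ.+ n) ≡ p ^ m * p ^ n
  ^-+ p zero    n = sym (*-identityˡ (p ^ n))
  ^-+ p (suc m) n = trans (cong (p *_) (^-+ p m n)) (sym (*-assoc p (p ^ m) (p ^ n)))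

  ^-pos : ∀ {p} → 0ℚ < p → ∀ n → 0ℚ < p ^ n
  ^-pos 0<p zero    = 0<1
  ^-pos 0<p (suc n) = *-pos 0<p (^-pos 0<p n)

  ^ℤ-pos : ∀ {p} → 0ℚ < p → ∀ i → 0ℚ < p ^ℤ i
  ^ℤ-pos 0<p (+ n)      = ^-pos 0<p n
  ^ℤ-pos 0<p (-[1+ n ]) = ⁻¹-pos (^-pos 0<p (suc n))

  exponent : ℕ → ℤ.ℤ
  exponent q = + 2 ℤ.* + q ℤ.- + 3

  -- The exponent `2q - 3` is negative exactly for `q = 0` and `q = 1`, where `_^ℤ_` is a
  -- reciprocal; hence the three cases.
  ^ℤ-exponent : ∀ {p} → 0ℚ < p → ∀ q → p ^ℤ exponent q * (p * (p * p)) ≡ p ^ q * p ^ q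
  ^ℤ-exponent {p} 0<p zero = trans (arith ((p ^ 3) ⁻¹) p) (⁻¹-inverseʳ (^-pos 0<p 3))
    where
    arith : ∀ i p → i * (p * (p * p)) ≡ (p * (p * (p * 1ℚ))) * i
    arith = solve-∀ ℚ-ring
  ^ℤ-exponent {p} 0<p (suc zero) = trans (arith ((p ^ 1) ⁻¹) p)
    (trans (cong (λ t → t * (p * p)) (⁻¹-inverseʳ (^-pos 0<p 1))) (arith′ p))
    where
    arith : ∀ i p → i * (p * (p * p)) ≡ (p * 1ℚ) * i * (p * p)
    arith = solve-∀ ℚ-ring
    arith′ : ∀ p → 1ℚ * (p * p) ≡ p * 1ℚ * (p * 1ℚ)
    arith′ = solve-∀ ℚ-ring
  ^ℤ-exponent {p} 0<p (suc (suc q)) = begin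
    p ^ℤ exponent (2 ℕ.+ q) * (p * (p * p))   ≡⟨ cong (λ i → p ^ℤ i * (p * (p * p))) exponent≡ ⟩
    p * p ^ (q ℕ.+ q) * (p * (p * p))         ≡⟨ cong (λ t → p * t * (p * (p * p))) (^-+ p q q) ⟩
    p * (p ^ q * p ^ q) * (p * (p * p))       ≡⟨ arith p (p ^ q) ⟩
    p * (p * p ^ q) * (p * (p * p ^ q))       ∎
    where
    open ≡-Reasoning
    arith : ∀ p x → p * (x * x) * (p * (p * p)) ≡ p * (p * x) * (p * (p * x))
    arith = solve-∀ ℚ-ring
    double : 2 ℕ.* (2 ℕ.+ q) ≡ 3 ℕ.+ suc (q ℕ.+ q)
    double = trans (ℕ.*-distribˡ-+ 2 2 q) (cong (λ j → 4 ℕ.+ (q ℕ.+ j)) (ℕ.+-identityʳ q))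
    exponent≡ : exponent (2 ℕ.+ q) ≡ + suc (q ℕ.+ q)
    exponent≡ = cong (ℤ._- + 3) (trans (sym (ℤ.pos-* 2 (2 ℕ.+ q))) (cong +_ double))

  -- In the closed form, `(2k + q)!` is `(2k)!` times a rising product, `(2k)! / (k! k!)` is
  -- `central k` times the `k`-th power of 4, and `scale q n` supplies twice that power over `q!`.
  -- The remaining `k + 1`, doubled, is the factor on the left.
  motzkinCount-scaled : ∀ k q → let n = suc (2 ℕ.* k ℕ.+ q) in
    fromℕ (motzkinCount n q) * fromℕ (suc (2 ℕ.* k ℕ.+ 1))
      ≡ central k * risingRatio q q k * fromℕ n ^ q * scale q n
  motzkinCount-scaled k q = scaled
    (fromℕ (motzkinCount n q)) (fromℕ (suc (2 ℕ.* k ℕ.+ 1))) (central k) (risingRatio q q k) (fromℕ n ^ q) (scale q n)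
    (fromℕ (suc k)) (fromℕ (k ℕ.!)) (fromℕ (q ℕ.!)) (fromℕ (4 ℕ.^ k)) (fromℕ ((2 ℕ.* k) ℕ.!)) (fromℕ ((2 ℕ.* k ℕ.+ q) ℕ.!))
    (*-pos (*-pos (*-pos (0<fromℕ-! k) (0<fromℕ-! k)) (0<fromℕ-! q)) (0<fromℕ (4 ℕ.^ k) {{ℕ.m^n≢0 4 k}}))
    b≡ count (central-! k) (risingRatio-! q q k) (scale-! k q)
    where
    n = suc (2 ℕ.* k ℕ.+ q)
    b≡ : fromℕ (suc (2 ℕ.* k ℕ.+ 1)) ≡ fromℕ (suc k) + fromℕ (suc k)
    b≡ = trans (cong fromℕ (trans (cong suc (trans (ℕ.+-comm (2 ℕ.* k) 1)
           (cong (λ j → suc (k ℕ.+ j)) (ℕ.+-identityʳ k)))) (cong suc (sym (ℕ.+-suc k k)))))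
         (fromℕ-+ (suc k) (suc k))
    count : fromℕ (motzkinCount n q) * (fromℕ (k ℕ.!) * (fromℕ (suc k) * fromℕ (k ℕ.!)) * fromℕ (q ℕ.!))
      ≡ fromℕ ((2 ℕ.* k ℕ.+ q) ℕ.!)
    count = begin
      fromℕ a * (fromℕ (k ℕ.!) * (fromℕ (suc k) * fromℕ (k ℕ.!)) * fromℕ (q ℕ.!))
        ≡⟨ cong (λ t → fromℕ a * (fromℕ (k ℕ.!) * t * fromℕ (q ℕ.!))) (fromℕ-suc-! k) ⟨
      fromℕ a * (fromℕ (k ℕ.!) * fromℕ (suc k ℕ.!) * fromℕ (q ℕ.!))
        ≡⟨ cong (λ t → fromℕ a * (t * fromℕ (q ℕ.!))) (fromℕ-* (k ℕ.!) (suc k ℕ.!)) ⟨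
      fromℕ a * (fromℕ (k ℕ.! ℕ.* suc k ℕ.!) * fromℕ (q ℕ.!))
        ≡⟨ cong (fromℕ a *_) (fromℕ-* (k ℕ.! ℕ.* suc k ℕ.!) (q ℕ.!)) ⟨
      fromℕ a * fromℕ (k ℕ.! ℕ.* suc k ℕ.! ℕ.* q ℕ.!)
        ≡⟨ fromℕ-* a (k ℕ.! ℕ.* suc k ℕ.! ℕ.* q ℕ.!) ⟨
      fromℕ (a ℕ.* (k ℕ.! ℕ.* suc k ℕ.! ℕ.* q ℕ.!))
        ≡⟨ cong fromℕ (motzkinCount-closed k q) ⟩
      fromℕ ((2 ℕ.* k ℕ.+ q) ℕ.!) ∎
      where
      open ≡-Reasoning
      a = motzkinCount n q

    scaled : ∀ A b c R M C s f g P F G → 0ℚ < f * f * g * P → b ≡ s + s →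
      A * (f * (s * f) * g) ≡ G → c * P * (f * f) ≡ F → R * M * F ≡ G → C * g ≡ 2ℚ * P →
      A * b ≡ c * R * M * C
    scaled A b c R M C s f g P F G 0<ffgP refl refl refl RMF≡G Cg≡2P = *-cancelʳ-≡ (f * f * g * P) 0<ffgP (begin
      A * (s + s) * (f * f * g * P)               ≡⟨ arith₁ A s f g P ⟩
      A * (f * (s * f) * g) * (2ℚ * P)            ≡⟨ cong₂ _*_ RMF≡G Cg≡2P ⟨
      R * M * (c * P * (f * f)) * (C * g)         ≡⟨ arith₂ R M c P f C g ⟩
      c * R * M * C * (f * f * g * P)             ∎)
      where
      open ≡-Reasoning
      arith₁ : ∀ A s f g P → A * (s + s) * (f * f * g * P) ≡ A * (f * (s * f) * g) * (2ℚ * P)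
      arith₁ = solve-∀ ℚ-ring
      arith₂ : ∀ R M c P f C g → R * M * (c * P * (f * f)) * (C * g) ≡ c * R * M * C * (f * f * g * P)
      arith₂ = solve-∀ ℚ-ring

  -- The m-th rational approximation of the square of (count / claimed equivalent), for n = 2k + q + 1.
  quotient² : ℕ → ℕ → ℕ → ℚ
  quotient² q k m = ½ * leibnizSum m * (central k * central k * fromℕ (suc (2 ℕ.* k)))
    * ratio q 0 k * (ratio q 1 k * ratio q 1 k) * (risingRatio q q k * risingRatio q q k)

  quotient²→1 : ∀ q → TendsTo1 (quotient² q)
  quotient²→1 q = TendsTo1-*
    {λ k m → ½ * leibnizSum m * (central k * central k * fromℕ (suc (2 ℕ.* k))) * ratio q 0 k * (ratio q 1 k * ratio q 1 k)}
    {λ k m → risingRatio q q k * risingRatio q q k}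
    (TendsTo1-*
      {λ k m → ½ * leibnizSum m * (central k * central k * fromℕ (suc (2 ℕ.* k))) * ratio q 0 k}
      {λ k m → ratio q 1 k * ratio q 1 k}
      (TendsTo1-* {λ k m → ½ * leibnizSum m * (central k * central k * fromℕ (suc (2 ℕ.* k)))} {λ k m → ratio q 0 k}
        wallis (ratio→1 q 0))
      (TendsTo1-* {λ k m → ratio q 1 k} {λ k m → ratio q 1 k} (ratio→1 q 1) (ratio→1 q 1)))
    (TendsTo1-* {λ k m → risingRatio q q k} {λ k m → risingRatio q q k} (risingRatio→1 q q) (risingRatio→1 q q))

  -- Squaring `motzkinCount-scaled` and splitting off `n` to the power `2q - 3` leaves the cube of
  -- `n` over the square of `2k + 2`. This equals `2k + 1`, which completes the Wallis factor, times
  -- `ratio q 0 k` and the square of `ratio q 1 k`.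
  motzkinCount² : ∀ q k m → 0ℚ < leibnizSum m → let n = suc (2 ℕ.* k ℕ.+ q)
                                                    A = fromℕ (motzkinCount n q) in
    A * A ≡ quotient² q k m * (fromℕ 2 * leibnizSum m ⁻¹) * (scale q n * scale q n) * fromℕ n ^ℤ exponent q
  motzkinCount² q k m 0<p = squared
    (fromℕ (motzkinCount n q)) (leibnizSum m) (leibnizSum m ⁻¹) (central k) (fromℕ (suc (2 ℕ.* k)))
    (fromℕ (suc (2 ℕ.* k ℕ.+ 1))) (ratio q 0 k) (ratio q 1 k) (risingRatio q q k) (scale q n)
    (fromℕ n ^ℤ exponent q) (fromℕ n ^ q) (fromℕ n)
    (0<fromℕ-suc (2 ℕ.* k ℕ.+ 1)) (⁻¹-inverseʳ 0<p)
    (trans (cong (λ j → ratio q 0 k * fromℕ (suc j)) (sym (ℕ.+-identityʳ (2 ℕ.* k)))) (ratio-cancel q 0 k))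
    (ratio-cancel q 1 k) (^ℤ-exponent (0<fromℕ-suc (2 ℕ.* k ℕ.+ q)) q) (motzkinCount-scaled k q)
    where
    n = suc (2 ℕ.* k ℕ.+ q)
    squared : ∀ A p i c a b r₁ r₂ R C Y M N → 0ℚ < b → p * i ≡ 1ℚ → r₁ * a ≡ N → r₂ * b ≡ N →
      Y * (N * (N * N)) ≡ M * M → A * b ≡ c * R * M * C →
      A * A ≡ ½ * p * (c * c * a) * r₁ * (r₂ * r₂) * (R * R) * (2ℚ * i) * (C * C) * Y
    squared A p i c a b r₁ r₂ R C Y M N 0<b pi≡1 r₁a≡N r₂b≡N YN³≡M² Ab≡ = *-cancelʳ-≡ (b * b) (*-pos 0<b 0<b) (begin
      A * A * (b * b)                                           ≡⟨ arith₁ A b ⟩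
      A * b * (A * b)                                           ≡⟨ cong (λ t → t * t) Ab≡ ⟩
      c * R * M * C * (c * R * M * C)                           ≡⟨ arith₂ c R M C ⟩
      M * M * (c * R * C * (c * R * C))                         ≡⟨ cong (_* (c * R * C * (c * R * C))) YN³≡M² ⟨
      Y * (N * (N * N)) * (c * R * C * (c * R * C))
        ≡⟨ cong₂ (λ t u → Y * (t * (u * u)) * (c * R * C * (c * R * C))) r₁a≡N r₂b≡N ⟨
      Y * (r₁ * a * (r₂ * b * (r₂ * b))) * (c * R * C * (c * R * C))
        ≡⟨ *-identityˡ _ ⟨
      1ℚ * (Y * (r₁ * a * (r₂ * b * (r₂ * b))) * (c * R * C * (c * R * C)))
        ≡⟨ cong (_* (Y * (r₁ * a * (r₂ * b * (r₂ * b))) * (c * R * C * (c * R * C)))) pi≡1 ⟨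
      p * i * (Y * (r₁ * a * (r₂ * b * (r₂ * b))) * (c * R * C * (c * R * C)))
        ≡⟨ arith₃ p i c a b r₁ r₂ R C Y ⟩
      ½ * p * (c * c * a) * r₁ * (r₂ * r₂) * (R * R) * (2ℚ * i) * (C * C) * Y * (b * b) ∎)
      where
      open ≡-Reasoning
      arith₁ : ∀ A b → A * A * (b * b) ≡ A * b * (A * b)
      arith₁ = solve-∀ ℚ-ring
      arith₂ : ∀ c R M C → c * R * M * C * (c * R * M * C) ≡ M * M * (c * R * C * (c * R * C))
      arith₂ = solve-∀ ℚ-ring
      arith₃ : ∀ p i c a b r₁ r₂ R C Y → p * i * (Y * (r₁ * a * (r₂ * b * (r₂ * b))) * (c * R * C * (c * R * C)))
        ≡ ½ * p * (c * c * a) * r₁ * (r₂ * r₂) * (R * R) * (2ℚ * i) * (C * C) * Y * (b * b)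
      arith₃ = solve-∀ ℚ-ring

  -- Comparison with the real-valued equivalent

  *-square-cancel-≤ : ∀ {p q} → 0ℚ ≤ q → p * p ≤ q * q → p ≤ q
  *-square-cancel-≤ {p} {q} 0≤q pp≤qq = ≮⇒≥ λ q<p → <-irrefl refl (begin-strict
    q * q     ≤⟨ *-monoʳ-≤ 0≤q (<⇒≤ q<p) ⟩
    q * p     <⟨ *-monoˡ-<-pos p {{positive (≤-<-trans 0≤q q<p)}} q<p ⟩
    p * p     ≤⟨ pp≤qq ⟩
    q * q     ∎)
    where open ≤-Reasoning

  p≤1+r⇐∣p-1∣≤r : ∀ {p r} → ∣ p - 1ℚ ∣ ≤ r → p ≤ 1ℚ + r
  p≤1+r⇐∣p-1∣≤r {p} h = ≤-from-sub {p} {1ℚ} (≤-trans (p≤∣p∣ (p - 1ℚ)) h)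

  1-r≤p⇐∣p-1∣≤r : ∀ {p r} → ∣ p - 1ℚ ∣ ≤ r → 1ℚ - r ≤ p
  1-r≤p⇐∣p-1∣≤r {p} {r} h = 0≤p-q⇒q≤p (subst (0ℚ ≤_) (arith r p)
    (0≤-sub (≤-trans (p≤∣p∣ (1ℚ - p)) (subst (_≤ r) (swap-∣-∣ p 1ℚ) h))))
    where
    arith : ∀ r p → r - (1ℚ - p) ≡ p - (1ℚ - r)
    arith = solve-∀ ℚ-ring

  -- `s` and `t` approximate the roots of `X` and `Y` from below within `e`. As `A` is `C` times the
  -- root of `x X Y` with `x` near 1, it is caught between multiples of rational products, and no
  -- exact root is needed.
  module _ {A C X Y x s t e δ : ℚ}
    (0≤A : 0ℚ ≤ A) (0<C : 0ℚ < C) (0<X : 0ℚ < X) (0<Y : 0ℚ < Y)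
    (0≤s : 0ℚ ≤ s) (0≤t : 0ℚ ≤ t) (0≤e : 0ℚ ≤ e) (0<δ : 0ℚ < δ) (δ≤1 : δ ≤ 1ℚ)
    (ss≤X : s * s ≤ X) (tt≤Y : t * t ≤ Y)
    (X≤ : X ≤ (s + e) * (s + e)) (Y≤ : Y ≤ (t + e) * (t + e))
    (x-close : ∣ x - 1ℚ ∣ ≤ δ) (A²≡ : A * A ≡ x * X * (C * C) * Y)
    where
    open ≤-Reasoning

    private
      0≤δ = <⇒≤ 0<δ
      0≤C = <⇒≤ 0<C
      0≤X = <⇒≤ 0<X
      0≤Y = <⇒≤ 0<Y
      0≤CC = *-nonNeg 0≤C 0≤C
      0≤1-δ = 0≤-sub δ≤1
      0≤1+δ = +-mono-≤ (<⇒≤ 0<1) 0≤δ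
      0≤s+e = +-mono-≤ 0≤s 0≤e
      0≤t+e = +-mono-≤ 0≤t 0≤e

    -- The root of `1 - δ` is replaced by the smaller `1 - δ`, which is rational; likewise `1 + δ`
    -- replaces its root in `squeeze-above`.
    squeeze-below : (1ℚ - δ) * (s * C * t) ≤ A
    squeeze-below = *-square-cancel-≤ 0≤A (begin
      (1ℚ - δ) * (s * C * t) * ((1ℚ - δ) * (s * C * t)) ≡⟨ arith₁ δ s C t ⟩
      (1ℚ - δ) * (1ℚ - δ) * (s * s) * (C * C) * (t * t)
        ≤⟨ *-mono-≤ (*-nonNeg (*-nonNeg (*-nonNeg 0≤1-δ 0≤1-δ) (*-nonNeg 0≤s 0≤s)) 0≤CC) 0≤Y
             (*-monoˡ-≤ 0≤CC (*-mono-≤ (*-nonNeg 0≤1-δ 0≤1-δ) 0≤X (*-monoʳ-≤ 0≤1-δ (sub-≤ {1ℚ} 0≤δ)) ss≤X)) tt≤Y ⟩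
      (1ℚ - δ) * 1ℚ * X * (C * C) * Y
        ≡⟨ cong (λ r → r * X * (C * C) * Y) (*-identityʳ (1ℚ - δ)) ⟩
      (1ℚ - δ) * X * (C * C) * Y
        ≤⟨ *-monoˡ-≤ 0≤Y (*-monoˡ-≤ 0≤CC (*-monoˡ-≤ 0≤X (1-r≤p⇐∣p-1∣≤r {x} x-close))) ⟩
      x * X * (C * C) * Y                               ≡⟨ A²≡ ⟨
      A * A                                             ∎)
      where
      arith₁ : ∀ δ s C t → (1ℚ - δ) * (s * C * t) * ((1ℚ - δ) * (s * C * t))
        ≡ (1ℚ - δ) * (1ℚ - δ) * (s * s) * (C * C) * (t * t)
      arith₁ = solve-∀ ℚ-ring

    squeeze-above : A ≤ (1ℚ + δ) * ((s + e) * C * (t + e))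
    squeeze-above = *-square-cancel-≤ (*-nonNeg 0≤1+δ (*-nonNeg (*-nonNeg 0≤s+e 0≤C) 0≤t+e)) (begin
      A * A                                             ≡⟨ A²≡ ⟩
      x * X * (C * C) * Y
        ≤⟨ *-monoˡ-≤ 0≤Y (*-monoˡ-≤ 0≤CC (*-monoˡ-≤ 0≤X (p≤1+r⇐∣p-1∣≤r {x} x-close))) ⟩
      (1ℚ + δ) * X * (C * C) * Y                        ≡⟨ cong (λ r → r * X * (C * C) * Y) (*-identityʳ (1ℚ + δ)) ⟨
      (1ℚ + δ) * 1ℚ * X * (C * C) * Y
        ≤⟨ *-mono-≤ (*-nonNeg (*-nonNeg (*-nonNeg 0≤1+δ (<⇒≤ 0<1)) 0≤X) 0≤CC) (*-nonNeg 0≤t+e 0≤t+e)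
             (*-monoˡ-≤ 0≤CC (*-mono-≤ (*-nonNeg 0≤1+δ (<⇒≤ 0<1)) (*-nonNeg 0≤s+e 0≤s+e)
               (*-monoʳ-≤ 0≤1+δ (subst (_≤ 1ℚ + δ) (+-identityʳ 1ℚ) (+-monoʳ-≤ 1ℚ 0≤δ))) X≤)) Y≤ ⟩
      (1ℚ + δ) * (1ℚ + δ) * ((s + e) * (s + e)) * (C * C) * ((t + e) * (t + e)) ≡⟨ arith₁ δ (s + e) C (t + e) ⟩
      (1ℚ + δ) * ((s + e) * C * (t + e)) * ((1ℚ + δ) * ((s + e) * C * (t + e))) ∎)
      where
      arith₁ : ∀ δ s C t → (1ℚ + δ) * (1ℚ + δ) * (s * s) * (C * C) * (t * t)
        ≡ (1ℚ + δ) * (s * C * t) * ((1ℚ + δ) * (s * C * t))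
      arith₁ = solve-∀ ℚ-ring

    -- Beyond `δ` times the product, the upper bound exceeds `s C t` by `(1 + δ) C (s + t + e) e`.
    -- Since `1 + δ ≤ 2` and `s + t + e ≤ B`, this is small as soon as `e` is.
    squeeze : ∀ {B ε} → s + t + e ≤ B → 2ℚ * C * B * e ≤ ε →
      ∣ A - s * C * t ∣ ≤ δ * (s * C * t) + ε
    squeeze {B} {ε} s+t+e≤B 2CBe≤ε = ∣∣-≤ above (subst (_≤ δ * G + ε) (sym (neg-sub A G)) below)
      where
      G = s * C * t
      0≤ε : 0ℚ ≤ ε
      0≤ε = ≤-trans (*-nonNeg (*-nonNeg (*-nonNeg 0≤2 0≤C) (≤-trans (+-mono-≤ (+-mono-≤ 0≤s 0≤t) 0≤e) s+t+e≤B)) 0≤e) 2CBe≤ε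
      below : G - A ≤ δ * G + ε
      below = begin
        G - A                          ≤⟨ +-monoʳ-≤ G (neg-antimono-≤ squeeze-below) ⟩
        G - (1ℚ - δ) * G               ≡⟨ arith₁ δ G ⟩
        δ * G + 0ℚ                     ≤⟨ +-monoʳ-≤ (δ * G) 0≤ε ⟩
        δ * G + ε                      ∎
        where
        arith₁ : ∀ δ G → G - (1ℚ - δ) * G ≡ δ * G + 0ℚ
        arith₁ = solve-∀ ℚ-ring
      above : A - G ≤ δ * G + ε
      above = begin
        A - G                                           ≤⟨ +-monoˡ-≤ (- G) squeeze-above ⟩
        (1ℚ + δ) * ((s + e) * C * (t + e)) - G          ≡⟨ arith₂ δ s C t e ⟩
        δ * G + (1ℚ + δ) * (C * (s + t + e) * e)
          ≤⟨ +-monoʳ-≤ (δ * G) (*-mono-≤ 0≤1+δ 0≤CBe (+-monoʳ-≤ 1ℚ δ≤1) (*-monoˡ-≤ 0≤e (*-monoʳ-≤ 0≤C s+t+e≤B))) ⟩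
        δ * G + 2ℚ * (C * B * e)                        ≡⟨ cong (λ r → δ * G + r) (arith₃ C B e) ⟩
        δ * G + 2ℚ * C * B * e                          ≤⟨ +-monoʳ-≤ (δ * G) 2CBe≤ε ⟩
        δ * G + ε                                       ∎
        where
        0≤CBe : 0ℚ ≤ C * B * e
        0≤CBe = *-nonNeg (*-nonNeg 0≤C (≤-trans (+-mono-≤ (+-mono-≤ 0≤s 0≤t) 0≤e) s+t+e≤B)) 0≤e
        arith₂ : ∀ δ s C t e → (1ℚ + δ) * ((s + e) * C * (t + e)) - s * C * t
          ≡ δ * (s * C * t) + (1ℚ + δ) * (C * (s + t + e) * e)
        arith₂ = solve-∀ ℚ-ring
        arith₃ : ∀ C B e → 2ℚ * (C * B * e) ≡ 2ℚ * C * B * e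
        arith₃ = solve-∀ ℚ-ring

  -- The claimed equivalent and its rational approximations

  root2/π : ℝ
  root2/π = √ (ι (fromℕ 2) *ᴿ recip π 0<π)

  equivalent : ℕ → ℕ → ℝ
  equivalent q n = root2/π *ᴿ ι (fromℕ (2 ℕ.^ q ℕ.* q ℕ.!) ⁻¹) *ᴿ ι (fromℕ (2 ℕ.^ n)) *ᴿ (n ^½ exponent q)

  leibnizSum-pos : ∀ {m} → 1 ℕ.≤ m → 0ℚ < leibnizSum m
  leibnizSum-pos {m} 1≤m = let δ , 0<δ , _ , δ≤π = 0<π
    in <-≤-trans 0<δ (subst (_≤ leibnizSum m) (+-identityˡ δ) (δ≤π m 1≤m))

  module _ {δ : ℚ} (0<δ : 0ℚ < δ) (δ≤1 : δ ≤ 1ℚ) (q k N : ℕ)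
    (close : ∀ m → N ℕ.≤ m → ∣ quotient² q k m - 1ℚ ∣ ≤ δ) where

    private
      n = suc (2 ℕ.* k ℕ.+ q)
      A = fromℕ (motzkinCount n q)
      C = scale q n
      Y = fromℕ n ^ℤ exponent q
      s t e : ℕ → ℚ
      s = seq root2/π
      t = seq (n ^½ exponent q)
      e m = + 1 / suc m

      0<Y : 0ℚ < Y
      0<Y = ^ℤ-pos (0<fromℕ-suc (2 ℕ.* k ℕ.+ q)) (exponent q)

    equivalent-seq : ∀ m → seq (equivalent q n) m ≡ s m * C * t m
    equivalent-seq m = cong (_* t m) (*-assoc (s m) _ _)

    approximation : ∀ {ε} → 0ℚ < ε → ∃[ M ] (∀ m → M ℕ.≤ m →
      ∣ A - seq (equivalent q n) m ∣ ≤ δ * ∣ seq (equivalent q n) m ∣ + ε)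
    approximation {ε} 0<ε =
      let B₁ , 0<B₁ , M₁ , s≤B₁ = bounded root2/π
          B₂ , 0<B₂ , M₂ , t≤B₂ = bounded (n ^½ exponent q)
          -- The final 1 accounts for `e m`, which is below 1 from `M₃` on.
          B      = B₁ + B₂ + 1ℚ
          0<B    = +-mono-< (+-mono-< 0<B₁ 0<B₂) 0<1
          D      = 2ℚ * C * B
          0<D    = *-pos (*-pos (positive⁻¹ 2ℚ) (0<scale q n)) 0<B
          M₃ , e≤1   = archimedean 1 0<1
          M₄ , e≤ε/D = archimedean 1 (*-pos 0<ε (⁻¹-pos 0<D))
          M₁₂    = M₁ ℕ.⊔ M₂
          M₃₄    = M₃ ℕ.⊔ M₄
      -- The empty Leibniz sum is 0, so `1 ≤ m` is required for its reciprocal to be a true inverse.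
      in (1 ℕ.⊔ N) ℕ.⊔ (M₁₂ ℕ.⊔ M₃₄) , λ m M≤m →
        let M₁₂₃₄≤m = ℕ.m⊔n≤o⇒n≤o (1 ℕ.⊔ N) (M₁₂ ℕ.⊔ M₃₄) M≤m
            1⊔N≤m = ℕ.m⊔n≤o⇒m≤o (1 ℕ.⊔ N) (M₁₂ ℕ.⊔ M₃₄) M≤m
            M₁₂≤m = ℕ.m⊔n≤o⇒m≤o M₁₂ M₃₄ M₁₂₃₄≤m
            M₃₄≤m = ℕ.m⊔n≤o⇒n≤o M₁₂ M₃₄ M₁₂₃₄≤m
            0<p   = leibnizSum-pos (ℕ.m⊔n≤o⇒m≤o 1 N 1⊔N≤m)
            X     = fromℕ 2 * leibnizSum m ⁻¹
            0<X   = *-pos {fromℕ 2} (0<fromℕ-suc 1) (⁻¹-pos 0<p)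
            -- `sqrtApprox` cuts its argument off at 0; positivity of `X` and `Y` undoes this.
            X⊔0≡X = p≥q⇒p⊔q≡p (<⇒≤ 0<X)
            Y⊔0≡Y = p≥q⇒p⊔q≡p (<⇒≤ 0<Y)
            0≤s   = 0≤sqrtApprox m X
            0≤t   = 0≤sqrtApprox m Y
            s≤    = ≤-trans (p≤∣p∣ (s m)) (s≤B₁ m (ℕ.m⊔n≤o⇒m≤o M₁ M₂ M₁₂≤m))
            t≤    = ≤-trans (p≤∣p∣ (t m)) (t≤B₂ m (ℕ.m⊔n≤o⇒n≤o M₁ M₂ M₁₂≤m))
            s+t+e≤B = +-mono-≤ (+-mono-≤ s≤ t≤) (<⇒≤ (e≤1 (ℕ.m⊔n≤o⇒m≤o M₃ M₄ M₃₄≤m)))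
            De≤ε  = subst (D * e m ≤_) (D[ε/D]≡ε D 0<D)
                      (*-monoʳ-≤ (<⇒≤ 0<D) (<⇒≤ (e≤ε/D (ℕ.m⊔n≤o⇒n≤o M₃ M₄ M₃₄≤m))))
            0≤G   = *-nonNeg (*-nonNeg 0≤s (<⇒≤ (0<scale q n))) 0≤t
        in subst₂ (λ g h → ∣ A - g ∣ ≤ δ * h + ε) (sym (equivalent-seq m))
          (sym (trans (cong ∣_∣ (equivalent-seq m)) (0≤p⇒∣p∣≡p 0≤G)))
          (squeeze {A} {C} {X} {Y} {quotient² q k m} {s m} {t m} {e m} {δ}
            (0≤fromℕ (motzkinCount n q)) (0<scale q n) 0<X 0<Y 0≤s 0≤t (0≤-/ 1 m) 0<δ δ≤1
            (subst (s m * s m ≤_) X⊔0≡X (SqrtApprox.sqrtApprox-lower m X))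
            (subst (t m * t m ≤_) Y⊔0≡Y (SqrtApprox.sqrtApprox-lower m Y))
            (subst (_≤ (s m + e m) * (s m + e m)) X⊔0≡X (<⇒≤ (SqrtApprox.sqrtApprox-upper m X)))
            (subst (_≤ (t m + e m) * (t m + e m)) Y⊔0≡Y (<⇒≤ (SqrtApprox.sqrtApprox-upper m Y)))
            (close m (ℕ.m⊔n≤o⇒n≤o 1 N 1⊔N≤m)) (motzkinCount² q k m 0<p)
            s+t+e≤B De≤ε)
      where
      D[ε/D]≡ε : ∀ D → 0ℚ < D → D * (ε * D ⁻¹) ≡ ε
      D[ε/D]≡ε D 0<D = trans (arith D ε (D ⁻¹)) (trans (cong (_* ε) (⁻¹-inverseʳ 0<D)) (*-identityˡ ε))
        where
        arith : ∀ D ε i → D * (ε * i) ≡ D * i * ε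
        arith = solve-∀ ℚ-ring


  -- This is the real inequality of `_∼_along_` spelled out on approximations, with the real
  -- tolerance replaced by a rational `δ`.
  Approximates : ℕ → ℚ → ℕ → Set
  Approximates q δ n = ∀ {η} → 0ℚ < η → ∃[ M ] (∀ m → M ℕ.≤ m →
      ∣ fromℕ (motzkinCount n q) - seq (equivalent q n) m ∣ ≤ δ * ∣ seq (equivalent q n) m ∣ + η)

  approximates : ∀ {q δ N k n} → 0ℚ < δ → δ ≤ 1ℚ →
    (∀ m → N ℕ.≤ m → ∣ quotient² q k m - 1ℚ ∣ ≤ δ) → n ≡ suc (2 ℕ.* k ℕ.+ q) → Approximates q δ n
  approximates {q} {δ} {N} {k} 0<δ δ≤1 close refl = approximation 0<δ δ≤1 q k N close

  large-k : ∀ {N k q n} → n ≡ suc (2 ℕ.* k ℕ.+ q) → suc (2 ℕ.* N ℕ.+ q) ℕ.≤ n → N ℕ.≤ k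
  large-k {N} {k} {q} refl N≤n = ℕ.*-cancelˡ-≤ 2 (ℕ.+-cancelʳ-≤ q (2 ℕ.* N) (2 ℕ.* k) (ℕ.s≤s⁻¹ N≤n))

  approximates-eventually : ∀ q {δ} → 0ℚ < δ → δ ≤ 1ℚ →
    ∃[ N ] (∀ k m → N ℕ.≤ k → N ℕ.≤ m → ∣ quotient² q k m - 1ℚ ∣ ≤ δ) →
    ∃[ N ] (∀ n → N ℕ.≤ n → n ℕ.% 2 ≢ q ℕ.% 2 → Approximates q δ n)
  -- The threshold serves twice: it forces `q < n`, so that `n` has the form `2k + q + 1`, and then
  -- `N ≤ k`.
  approximates-eventually q 0<δ δ≤1 (N , close) = suc (2 ℕ.* N ℕ.+ q) , λ n N≤n n≢q →
    let k , n≡ = opposite-parity (ℕ.≤-trans (s≤s (ℕ.m≤n+m q (2 ℕ.* N))) N≤n) n≢q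
    in approximates 0<δ δ≤1 (λ m → close k m (large-k n≡ N≤n)) n≡

  0<1⊓ : ∀ {p} → 0ℚ < p → 0ℚ < 1ℚ ⊓ p
  0<1⊓ {p} 0<p with ≤-total 1ℚ p
  ... | inj₁ 1≤p = subst (0ℚ <_) (sym (p≤q⇒p⊓q≡p 1≤p)) 0<1
  ... | inj₂ p≤1 = subst (0ℚ <_) (sym (p≥q⇒p⊓q≡q p≤1)) 0<p

  motzkinCount-equivalent : ∀ q →
    (λ n → ι (fromℕ (motzkinCount n q))) ∼ equivalent q along (λ n → n ℕ.% 2 ≢ q ℕ.% 2)
  motzkinCount-equivalent q ε (δ₀ , 0<δ₀ , M₀ , δ₀≤ε) =
    -- `δ₀` is a positive rational that the approximations of `ε` eventually dominate; it is capped
    -- at 1 because `squeeze` requires `δ ≤ 1`.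
    let N , approximates-n = approximates-eventually q (0<1⊓ 0<δ₀) (p⊓q≤p 1ℚ δ₀) (quotient²→1 q (0<1⊓ 0<δ₀))
    in N , λ n N≤n n≢q η 0<η →
      let M , bound = approximates-n n N≤n n≢q 0<η
      in M₀ ℕ.⊔ M , λ m m≥ → ≤-trans (bound m (ℕ.m⊔n≤o⇒n≤o M₀ M m≥))
        (+-monoˡ-≤ η (*-monoˡ-≤ (0≤∣p∣ (seq (equivalent q n) m))
          (≤-trans (p⊓q≤q 1ℚ δ₀) (subst (_≤ seq ε m) (+-identityˡ δ₀) (δ₀≤ε m (ℕ.m⊔n≤o⇒m≤o M₀ M m≥))))))

open import Data.Integer.Base as ℤ using (+_)
open import Data.Nat.Base using (ℕ; _*_; _^_; _%_; _!)
open import Data.Product.Base using (_×_; _,_)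
open import Relation.Binary.PropositionalEquality using (_≡_; _≢_)
open import Defs using (motzkinCount; ι; fromℕ; _⁻¹; _*ᴿ_; √_; π; 0<π; recip; _^½_; _∼_along_)

proposition1 : (q : ℕ) →
    ((n : ℕ) → n % 2 ≡ q % 2 → motzkinCount n q ≡ 0)
    × ((λ n → ι (fromℕ (motzkinCount n q)))
    ∼ (λ n → √ (ι (fromℕ 2) *ᴿ recip π 0<π)
    *ᴿ ι (fromℕ (2 ^ q * q !) ⁻¹)
    *ᴿ ι (fromℕ (2 ^ n))
    *ᴿ (n ^½ (+ 2 ℤ.* + q ℤ.- + 3)))
    along (λ n → n % 2 ≢ q % 2))
proposition1 q = Counting.motzkinCount-parity q , Asymptotics.motzkinCount-equivalent q
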